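{- Let $m\ge2$ and $1\le k\le 3$, and let $p_{8k}(n)$, $\mu=\mu_m(k)$ and $c_1$ be as defined in the context. The following hold: (i) If $c_1^\alpha\not\equiv0\pmod m$ for every $\alpha\ge1$, then for all $\alpha\ge 1$ and $n\ge0$, $$p_{8k}\left(2^{2\mu\alpha}n+\frac{(2k+3)\cdot2^{2\mu\alpha-1}-k}{3}\right)\equiv0\pmod m.$$ (ii) If $\alpha$ is a positive integer such that $c_1^\alpha\equiv0\pmod m$, then for all $n\ge0$, $$p_{8k}\left(2^{2\mu\alpha-1}n+\frac{k(2^{2\mu\alpha}-1)}{3}\right)\equiv0\pmod m.$$
   Context: The integers $p_j(n)$ are defined by $\prod_{n\ge1}(1-q^n)^j=\sum_{n\ge0}p_j(n)q^n$. The integer sequences $A_k(\alpha),B_k(\alpha)$ ($1\le k\le3$, $\alpha\ge0$) are defined as follows: for each $k$ both satisfy $s(\alpha+4)=f(k)s(\alpha+2)+g(k)s(\alpha)$ for $\alpha\ge0$, where $f(1)=-8,\ g(1)=0$; $f(2)=104,\ g(2)=-2^{14}$; $f(3)=-3520,\ g(3)=-2^{22}$, with initial values $(s(0),s(1),s(2),s(3))$: $A_1:(1,-8,-8,64)$, $B_1:(0,0,0,0)$; $A_2:(1,128,104,-3072)$, $B_2:(0,1,-2048,104)$; $A_3:(1,-2048,-1472,3014656)$, $B_3:(0,-24,49152,84480)$. For $m\ge2$, $\mu_m(k)=\min\{\alpha\ge1 : B_k(2\alpha-1)\equiv0\pmod m\}$ (this minimum is known to exist for every $m\ge 2$), and $c_1$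 is the integer with $0\le c_1\le m-1$ and $c_1\equiv A_k(2\mu_m(k)-1)\pmod m$. -}

module Defs where

open import Data.Bool.Base using (if_then_else_)
open import Data.Fin.Base using (Fin; toℕ; zero; suc)
open import Data.Integer.Base using (ℤ; +_; -_; 0ℤ; 1ℤ; _+_; _*_; _-_; _^_)
open import Data.Integer.Divisibility using (_∣_)
import Data.Integer.Properties as ℤ
open import Data.Nat.Base as ℕ using (ℕ; zero; suc; _≤_; _<_; _∸_; z≤n; s≤s; _≡ᵇ_; _≤′_)
import Data.Nat.Properties as ℕ
open import Data.Product.Base using (_×_)
open import Relation.Binary.PropositionalEquality
  using (_≡_; refl; sym; trans; cong; cong₂; module ≡-Reasoning)
open import Algebra.Properties.Monoid.Sum ℤ.+-0-monoid
  using (sum-syntax; sum⁺-syntax; sum-cong-≗; sum-replicate-zero)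

infix 4 _≡_[mod_]

_≡_[mod_] : ℤ → ℤ → ℕ → Set
a ≡ b [mod m ] = + m ∣ (a - b)

IsMin : (ℕ → Set) → ℕ → Set
IsMin P x = P x × (∀ y → P y → x ≤ y)

------------------------------------------------------------------------
-- Formal power series over ℤ, given by their coefficients

Series : Set
Series = ℕ → ℤ

q^ : ℕ → Series
q^ i n = if n ≡ᵇ i then 1ℤ else 0ℤ

infixl 6 _⊖_
infixl 7 _⋆_
infixr 8 _⋆^_

_⊖_ : Series → Series → Series
(f ⊖ g) n = f n - g n

_⋆_ : Series → Series → Series
(f ⋆ g) n = ∑[ i ≤ n ] (f (toℕ i) * g (n ∸ toℕ i))

_⋆^_ : Series → ℕ → Series
f ⋆^ zero  = q^ 0
f ⋆^ suc j = f ⋆ (f ⋆^ j)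

-- ∏_{i=1}^{N} (1 - q^i)^j

partialProduct : ℕ → ℕ → Series
partialProduct j zero    = q^ 0
partialProduct j (suc N) = ((q^ 0 ⊖ q^ (suc N)) ⋆^ j) ⋆ partialProduct j N

-- The coefficient of q^n in the infinite product.  The factors with i > n
-- do not affect it, so it can be read off from the n-th partial product;
-- see p-stable.

p : ℕ → ℕ → ℤ
p j n = partialProduct j n n

private
  OneUpTo : ℕ → Series → Set
  OneUpTo N f = ∀ n → n ≤ N → f n ≡ q^ 0 n

  ⋆-oneUpTo : ∀ {N f} → OneUpTo N f → ∀ g n → n ≤ N → (f ⋆ g) n ≡ g n
  ⋆-oneUpTo {N} {f} f≈1 g n n≤N = begin
    f 0 * g n + (∑[ i < n ] (f (suc (toℕ i)) * g (n ∸ suc (toℕ i))))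
      ≡⟨ cong₂ _+_ (cong (_* g n) (f≈1 0 z≤n)) (sum-cong-≗ {n} vanish) ⟩
    1ℤ * g n + (∑[ i < n ] 0ℤ)
      ≡⟨ cong₂ _+_ (ℤ.*-identityˡ (g n)) (sum-replicate-zero n) ⟩
    g n + 0ℤ
      ≡⟨ ℤ.+-identityʳ (g n) ⟩
    g n ∎
    where
    open ≡-Reasoning
    open import Data.Fin.Properties using (toℕ<n)
    vanish : (i : Fin n) → f (suc (toℕ i)) * g (n ∸ suc (toℕ i)) ≡ 0ℤ
    vanish i = cong (_* g (n ∸ suc (toℕ i)))
                    (f≈1 (suc (toℕ i)) (ℕ.≤-trans (toℕ<n i) n≤N))

  q^-< : ∀ {n i} → n < i → q^ i n ≡ 0ℤ
  q^-< {zero}  {suc i} _         = refl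
  q^-< {suc n} {suc i} (s≤s n<i) = q^-< n<i

  factor-oneUpTo : ∀ N → OneUpTo N (q^ 0 ⊖ q^ (suc N))
  factor-oneUpTo N n n≤N = trans (cong (λ z → q^ 0 n - z) (q^-< (s≤s n≤N)))
                                 (ℤ.+-identityʳ (q^ 0 n))

  ⋆^-oneUpTo : ∀ {N f} → OneUpTo N f → ∀ j → OneUpTo N (f ⋆^ j)
  ⋆^-oneUpTo         f≈1 zero    n n≤N = refl
  ⋆^-oneUpTo {N} {f} f≈1 (suc j) n n≤N =
    trans (⋆-oneUpTo {N} {f} f≈1 (f ⋆^ j) n n≤N) (⋆^-oneUpTo {N} {f} f≈1 j n n≤N)

p-stable : ∀ j n N → n ≤ N → partialProduct j N n ≡ p j n
p-stable j n N n≤N = go (ℕ.≤⇒≤′ n≤N)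
  where
  go : ∀ {N} → n ≤′ N → partialProduct j N n ≡ p j n
  go (ℕ.≤′-reflexive refl)    = refl
  go (ℕ.≤′-step {N} n≤′N) = trans
    (⋆-oneUpTo {N} {(q^ 0 ⊖ q^ (suc N)) ⋆^ j}
      (⋆^-oneUpTo {N} {q^ 0 ⊖ q^ (suc N)} (factor-oneUpTo N) j)
      (partialProduct j N) n (ℕ.≤′⇒≤ n≤′N))
    (go n≤′N)

------------------------------------------------------------------------
-- The sequences A_k and B_k

-- The solution of s(α+4) = a s(α+2) + b s(α) with given s(0), …, s(3).

recurrence : (a b s₀ s₁ s₂ s₃ : ℤ) → ℕ → ℤ
recurrence a b s₀ s₁ s₂ s₃ = s
  where
  s : ℕ → ℤ
  s 0 = s₀
  s 1 = s₁
  s 2 = s₂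
  s 3 = s₃
  s (suc (suc (suc (suc α)))) = a * s (suc (suc α)) + b * s α

-- Only 1 ≤ k ≤ 3 is meaningful; the other values are junk.

f g : ℕ → ℤ
f 1 = - + 8
f 2 = + 104
f 3 = - + 3520
f _ = 0ℤ

g 1 = 0ℤ
g 2 = - ((+ 2) ^ 14)
g 3 = - ((+ 2) ^ 22)
g _ = 0ℤ

A B : ℕ → ℕ → ℤ
A 1 = recurrence (f 1) (g 1) (+ 1) (- + 8)    (- + 8)    (+ 64)
A 2 = recurrence (f 2) (g 2) (+ 1) (+ 128)    (+ 104)    (- + 3072)
A 3 = recurrence (f 3) (g 3) (+ 1) (- + 2048) (- + 1472) (+ 3014656)
A _ = λ _ → 0ℤ

B 1 = recurrence (f 1) (g 1) (+ 0) (+ 0)    (+ 0)      (+ 0)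
B 2 = recurrence (f 2) (g 2) (+ 0) (+ 1)    (- + 2048) (+ 104)
B 3 = recurrence (f 3) (g 3) (+ 0) (- + 24) (+ 49152)  (+ 84480)
B _ = λ _ → 0ℤ

-- μ = μ_m(k), the least α ≥ 1 with B_k(2α-1) ≡ 0 (mod m).  Stated as a
-- relation; the truncated subtraction is exact because α ≥ 1.

IsMu : (m k μ : ℕ) → Set
IsMu m k = IsMin (λ α → 1 ≤ α × B k (2 ℕ.* α ∸ 1) ≡ 0ℤ [mod m ])

-- c is the residue of A_k(2μ-1) modulo m in the range 0 ≤ c ≤ m - 1.

IsC₁ : (m k μ : ℕ) (c : ℤ) → Set
IsC₁ m k μ c =
  0ℤ ℤ≤ c × c ℤ≤ + m - 1ℤ × c ≡ A k (2 ℕ.* μ ∸ 1) [mod m ]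
  where open import Data.Integer.Base using () renaming (_≤_ to _ℤ≤_)

{-# OPTIONS --safe #-}
-- Let E = ∏ (1 - qⁿ) and u = E⁸, so that p₈ₖ(n) is the coefficient b(N) of uᵏ
-- attached to the exponent N = 3n + k of q in η(3z)⁸ᵏ.  Hecke theory at 2
-- provides a companion h with b(2N) = A(1) b(N/2) + B(1) h(N), whose values at
-- 4N are again combinations of b(N/2) and h(N), whence
--   b(2^(2a-1) N) = A(2a-1) b(N/2) + B(2a-1) h(N).
-- Modulo m the case a = μ reads b(2^(2μ-1) N) ≡ c₁ b(N/2), and iterating it
-- gives b(2^(2μα-1) N) ≡ c₁^α b(N/2).  Part (ii) is the case N = 3n + 2k, and
-- part (i) its subcase N = 6n + 2k + 3, where N is odd and hence b(N/2) = 0.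
--
-- The Hecke relations are consequences of u(q) u(-q) u(q⁴) = u(q²)³ and
-- u(-q) = u(q) + 16 q u(q⁴).  The latter is Jacobi's quartic theta identity.  By
-- Gauss, θ = Σ (-1)ⁿ q^{n²} = E² / E(q²), and θ(q) + θ(-q) = 2 θ(-q⁴); from this
-- both θ(q)² + θ(-q)² = 2 θ(-q²)² and Jacobi's identity follow because the two
-- sides satisfy the same equation relating f(q) to f(q²), which has only one
-- solution.

module Submission where

open import Algebra.Bundles using (CommutativeRing)
open import Algebra.Solver.Ring.AlmostCommutativeRing
  using (fromCommutativeRing; _-Raw-AlmostCommutative⟶_)
import Algebra.Solver.Ring as RingSolver
open import Algebra.Structures using (IsCommutativeRing)
open import Data.Integer.Base as ℤ using (ℤ; +_; 0ℤ; 1ℤ)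
open import Data.Integer.Divisibility.Signed
  using (_∣_; divides; ∣ᵤ⇒∣; ∣⇒∣ᵤ; ∣m∣n⇒∣m+n; ∣m⇒∣m*n; ∣n⇒∣m*n)
import Data.Integer.Properties as ℤ
import Data.Integer.Tactic.RingSolver as ℤ-Tactic
open import Data.Maybe.Base using (Maybe; just; nothing)
open import Data.Nat.Base as ℕ using (ℕ; zero; suc; z≤n; s≤s)
open import Data.Nat.DivMod using (m*n/n≡m)
import Data.Nat.Properties as ℕ
import Data.Nat.Tactic.RingSolver as ℕ-Tactic
open import Data.Product.Base using (_×_; _,_)
open import Data.Sum.Base using (inj₁; inj₂)
open import Level using (0ℓ)
open import Relation.Binary.PropositionalEquality as ≡
  using (_≡_; _≢_; cong; cong₂; subst; module ≡-Reasoning)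
open import Relation.Nullary.Decidable.Core using (yes; no)
open import Relation.Nullary.Negation.Core using (¬_; contradiction)
open import Defs
  using (Series; q^; _⋆_; _⊖_; _⋆^_; partialProduct; p; p-stable;
         A; B; recurrence; IsMu; IsC₁; _≡_[mod_])

-- The commutative ring of formal power series

module SeriesRing where
  open ≡ using (refl; sym; trans)

  record _≋_ (f g : Series) : Set where
    constructor pointwise
    field coeff : ∀ n → f n ≡ g n
  open _≋_ public

  infix 4 _≋_

  tail : Series → Series
  tail f n = f (suc n)

  -- The operations are opaque so that unification and the ring solver treat
  -- series as atoms instead of unfolding coefficients.
  opaque
    infixl 6 _⊕_
    infixl 7 _∙_

    _⊕_ : Series → Series → Series
    (f ⊕ g) n = f n ℤ.+ g n

    _∙_ : Series → Series → Series
    _∙_ = _⋆_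

    ⊝_ : Series → Series
    (⊝ f) n = ℤ.- f n

    ι : ℤ → Series
    ι c zero    = c
    ι c (suc n) = 0ℤ

    -- σ f is f(-q) and δ f is f(q²).

    σ : Series → Series
    σ f zero    = f 0
    σ f (suc n) = ℤ.- σ (tail f) n

    δ : Series → Series
    δ f zero          = f 0
    δ f (suc zero)    = 0ℤ
    δ f (suc (suc n)) = δ (tail f) n

  opaque
    unfolding _∙_

    ⊕-coeff : ∀ f g n → (f ⊕ g) n ≡ f n ℤ.+ g n
    ⊕-coeff _ _ _ = refl

    ⊝-coeff : ∀ f n → (⊝ f) n ≡ ℤ.- f n
    ⊝-coeff _ _ = refl

    ∙-zero : ∀ f g → (f ∙ g) 0 ≡ f 0 ℤ.* g 0
    ∙-zero f g = ℤ.+-identityʳ (f 0 ℤ.* g 0)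

    ∙-suc : ∀ f g n → (f ∙ g) (suc n) ≡ f 0 ℤ.* g (suc n) ℤ.+ (tail f ∙ g) n
    ∙-suc _ _ _ = refl

    -- The convolution unfolds by definition at the constant term of the left factor. Peeling off
    -- the last summand instead gives the mirrored recursion, on which commutativity rests.
    ∙-sucʳ : ∀ f g n → (f ∙ g) (suc n) ≡ (f ∙ tail g) n ℤ.+ f (suc n) ℤ.* g 0
    ∙-sucʳ f g zero    = cong₂ ℤ._+_ (sym (∙-zero f (tail g))) (∙-zero (tail f) g)
    ∙-sucʳ f g (suc n) = trans
      (cong (λ x → f 0 ℤ.* g (suc (suc n)) ℤ.+ x) (∙-sucʳ (tail f) g n))
      (sym (ℤ.+-assoc (f 0 ℤ.* g (suc (suc n))) _ _))

    -- Only indices up to `n` occur in the Cauchy product. This later allows infinite products to be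
    -- replaced by finite ones, one coefficient at a time.
    ∙-local : ∀ {f f′ g g′} n → (∀ i → i ℕ.≤ n → f i ≡ f′ i) →
              (∀ i → i ℕ.≤ n → g i ≡ g′ i) → (f ∙ g) n ≡ (f′ ∙ g′) n
    ∙-local zero    ff gg = cong₂ (λ x y → x ℤ.* y ℤ.+ 0ℤ) (ff 0 z≤n) (gg 0 z≤n)
    ∙-local (suc n) ff gg = cong₂ ℤ._+_
      (cong₂ ℤ._*_ (ff 0 z≤n) (gg (suc n) ℕ.≤-refl))
      (∙-local n (λ i i≤n → ff (suc i) (s≤s i≤n)) (λ i i≤n → gg i (ℕ.m≤n⇒m≤1+n i≤n)))

    ∙-cong′ : ∀ {f f′ g g′} → (∀ i → f i ≡ f′ i) → (∀ i → g i ≡ g′ i) → ∀ n → (f ∙ g) n ≡ (f′ ∙ g′) n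
    ∙-cong′ ff gg n = ∙-local n (λ i _ → ff i) (λ i _ → gg i)

    ∙-comm′ : ∀ f g n → (f ∙ g) n ≡ (g ∙ f) n
    ∙-comm′ f g zero    = cong (ℤ._+ 0ℤ) (ℤ.*-comm (f 0) (g 0))
    ∙-comm′ f g (suc n) = begin
      f 0 ℤ.* g (suc n) ℤ.+ (tail f ∙ g) n ≡⟨ cong₂ ℤ._+_ (ℤ.*-comm (f 0) _) (∙-comm′ (tail f) g n) ⟩
      g (suc n) ℤ.* f 0 ℤ.+ (g ∙ tail f) n ≡⟨ ℤ.+-comm (g (suc n) ℤ.* f 0) _ ⟩
      (g ∙ tail f) n ℤ.+ g (suc n) ℤ.* f 0 ≡⟨ sym (∙-sucʳ g f n) ⟩
      (g ∙ f) (suc n) ∎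
      where open ≡-Reasoning

    ∙-distribʳ′ : ∀ h f g n → ((f ⊕ g) ∙ h) n ≡ (f ∙ h) n ℤ.+ (g ∙ h) n
    ∙-distribʳ′ h f g zero    = lemma (f 0) (g 0) (h 0)
      where
      lemma : ∀ a b c → (a ℤ.+ b) ℤ.* c ℤ.+ 0ℤ ≡ (a ℤ.* c ℤ.+ 0ℤ) ℤ.+ (b ℤ.* c ℤ.+ 0ℤ)
      lemma = ℤ-Tactic.solve-∀
    ∙-distribʳ′ h f g (suc n) = trans
      (cong (λ x → (f 0 ℤ.+ g 0) ℤ.* h (suc n) ℤ.+ x) (∙-distribʳ′ h (tail f) (tail g) n))
      (lemma (f 0) (g 0) (h (suc n)) ((tail f ∙ h) n) ((tail g ∙ h) n))
      where
      lemma : ∀ a b c x y → (a ℤ.+ b) ℤ.* c ℤ.+ (x ℤ.+ y) ≡ (a ℤ.* c ℤ.+ x) ℤ.+ (b ℤ.* c ℤ.+ y)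
      lemma = ℤ-Tactic.solve-∀

    -- Scaling is pointwise here because the tail of a product has that form: `tail (f ∙ g)` is
    -- `tail g` scaled by `f 0`, plus `tail f ∙ g`.
    ∙-scaleˡ : ∀ c f g n → ((λ i → c ℤ.* f i) ∙ g) n ≡ c ℤ.* (f ∙ g) n
    ∙-scaleˡ c f g zero    = lemma c (f 0) (g 0)
      where
      lemma : ∀ a b c → (a ℤ.* b) ℤ.* c ℤ.+ 0ℤ ≡ a ℤ.* (b ℤ.* c ℤ.+ 0ℤ)
      lemma = ℤ-Tactic.solve-∀
    ∙-scaleˡ c f g (suc n) = trans
      (cong (λ x → c ℤ.* f 0 ℤ.* g (suc n) ℤ.+ x) (∙-scaleˡ c (tail f) g n))
      (lemma c (f 0) (g (suc n)) _)
      where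
      lemma : ∀ a b c x → (a ℤ.* b) ℤ.* c ℤ.+ a ℤ.* x ≡ a ℤ.* (b ℤ.* c ℤ.+ x)
      lemma = ℤ-Tactic.solve-∀

    ∙-assoc′ : ∀ f g h n → ((f ∙ g) ∙ h) n ≡ (f ∙ (g ∙ h)) n
    ∙-assoc′ f g h zero    = lemma (f 0) (g 0) (h 0)
      where
      lemma : ∀ a b c → (a ℤ.* b ℤ.+ 0ℤ) ℤ.* c ℤ.+ 0ℤ ≡ a ℤ.* (b ℤ.* c ℤ.+ 0ℤ) ℤ.+ 0ℤ
      lemma = ℤ-Tactic.solve-∀
    ∙-assoc′ f g h (suc n) = begin
      (f ∙ g) 0 ℤ.* h (suc n) ℤ.+ (tail (f ∙ g) ∙ h) n
        ≡⟨ cong (λ x → (f ∙ g) 0 ℤ.* h (suc n) ℤ.+ x) (∙-distribʳ′ h f₀g (tail f ∙ g) n) ⟩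
      (f ∙ g) 0 ℤ.* h (suc n) ℤ.+ ((f₀g ∙ h) n ℤ.+ ((tail f ∙ g) ∙ h) n)
        ≡⟨ cong₂ (λ x y → (f ∙ g) 0 ℤ.* h (suc n) ℤ.+ (x ℤ.+ y))
             (∙-scaleˡ (f 0) (tail g) h n) (∙-assoc′ (tail f) g h n) ⟩
      (f ∙ g) 0 ℤ.* h (suc n) ℤ.+ (f 0 ℤ.* (tail g ∙ h) n ℤ.+ (tail f ∙ (g ∙ h)) n)
        ≡⟨ lemma (f 0) (g 0) (h (suc n)) _ _ ⟩
      f 0 ℤ.* (g ∙ h) (suc n) ℤ.+ (tail f ∙ (g ∙ h)) n ∎
      where
      open ≡-Reasoning
      f₀g : Series
      f₀g i = f 0 ℤ.* tail g i
      lemma : ∀ a b c x y → (a ℤ.* b ℤ.+ 0ℤ) ℤ.* c ℤ.+ (a ℤ.* x ℤ.+ y) ≡ a ℤ.* (b ℤ.* c ℤ.+ x) ℤ.+ y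
      lemma = ℤ-Tactic.solve-∀

    ∙-zeroˡ′ : ∀ f n → ((λ _ → 0ℤ) ∙ f) n ≡ 0ℤ
    ∙-zeroˡ′ f zero    = refl
    ∙-zeroˡ′ f (suc n) = trans (ℤ.+-identityˡ _) (∙-zeroˡ′ f n)

    ι-coeff : ∀ c f n → (ι c ∙ f) n ≡ c ℤ.* f n
    ι-coeff c f zero    = ℤ.+-identityʳ _
    ι-coeff c f (suc n) = trans (cong (λ x → c ℤ.* f (suc n) ℤ.+ x) (∙-zeroˡ′ f n)) (ℤ.+-identityʳ _)

    ι0-coeff : ∀ n → ι 0ℤ n ≡ 0ℤ
    ι0-coeff zero    = refl
    ι0-coeff (suc n) = refl

    ι1-coeff : ∀ n → ι 1ℤ n ≡ q^ 0 n
    ι1-coeff zero    = refl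
    ι1-coeff (suc n) = refl

    ∙-identityˡ′ : ∀ f n → (ι 1ℤ ∙ f) n ≡ f n
    ∙-identityˡ′ f n = trans (ι-coeff 1ℤ f n) (ℤ.*-identityˡ (f n))

    series-isCommutativeRing : IsCommutativeRing _≋_ _⊕_ _∙_ ⊝_ (ι 0ℤ) (ι 1ℤ)
    series-isCommutativeRing = record
      { isRing = record
        { +-isAbelianGroup = record
          { isGroup = record
            { isMonoid = record
              { isSemigroup = record
                { isMagma = record
                  { isEquivalence = record
                    { refl = pointwise λ _ → refl
                    ; sym = λ e → pointwise λ n → sym (coeff e n)
                    ; trans = λ e e′ → pointwise λ n → trans (coeff e n) (coeff e′ n)
                    }
                  ; ∙-cong = λ e e′ → pointwise λ n → cong₂ ℤ._+_ (coeff e n) (coeff e′ n)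
                  }
                ; assoc = λ f g h → pointwise λ n → ℤ.+-assoc (f n) (g n) (h n)
                }
              ; identity = (λ f → pointwise λ n → trans (cong (ℤ._+ f n) (ι0-coeff n)) (ℤ.+-identityˡ (f n)))
                         , (λ f → pointwise λ n → trans (cong (λ x → f n ℤ.+ x) (ι0-coeff n)) (ℤ.+-identityʳ (f n)))
              }
            ; inverse = (λ f → pointwise λ n → trans (ℤ.+-inverseˡ (f n)) (sym (ι0-coeff n)))
                      , (λ f → pointwise λ n → trans (ℤ.+-inverseʳ (f n)) (sym (ι0-coeff n)))
            ; ⁻¹-cong = λ e → pointwise λ n → cong ℤ.-_ (coeff e n)
            }
          ; comm = λ f g → pointwise λ n → ℤ.+-comm (f n) (g n)
          }
        ; *-cong = λ e e′ → pointwise (∙-cong′ (coeff e) (coeff e′))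
        ; *-assoc = λ f g h → pointwise (∙-assoc′ f g h)
        ; *-identity = (λ f → pointwise (∙-identityˡ′ f))
                     , (λ f → pointwise λ n → trans (∙-comm′ f (ι 1ℤ) n) (∙-identityˡ′ f n))
        ; distrib = (λ h f g → pointwise λ n → trans (∙-comm′ h (f ⊕ g) n)
                       (trans (∙-distribʳ′ h f g n) (cong₂ ℤ._+_ (∙-comm′ f h n) (∙-comm′ g h n))))
                  , (λ h f g → pointwise (∙-distribʳ′ h f g))
        }
      ; *-comm = λ f g → pointwise (∙-comm′ f g)
      }

  seriesRing : CommutativeRing 0ℓ 0ℓ
  seriesRing = record { isCommutativeRing = series-isCommutativeRing }

-- Integer constants and a ring solver for series

module PowerSeries where
  open SeriesRing public
  open CommutativeRing seriesRing hiding (zero) public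
  open import Algebra.Properties.CommutativeSemiring.Exp commutativeSemiring public

  opaque
    unfolding _∙_

    ι-+ : ∀ a b → ι (a ℤ.+ b) ≈ ι a + ι b
    ι-+ a b = pointwise λ { zero → ≡.refl ; (suc n) → ≡.refl }

    ι-* : ∀ a b → ι (a ℤ.* b) ≈ ι a * ι b
    ι-* a b = pointwise λ
      { zero → ≡.sym (ι-coeff a (ι b) 0) ; (suc n) → ≡.sym (≡.trans (ι-coeff a (ι b) (suc n)) (ℤ.*-zeroʳ a)) }

    ι-neg : ∀ a → ι (ℤ.- a) ≈ - ι a
    ι-neg a = pointwise λ { zero → ≡.refl ; (suc n) → ≡.refl }

  -- With coefficients in ℤ embedded by `ι`, the solver computes with numerals such as 16 or -2048
  -- instead of treating them as atoms.
  ι-hom : ℤ.+-*-rawRing -Raw-AlmostCommutative⟶ fromCommutativeRing seriesRing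
  ι-hom = record
    { ⟦_⟧ = ι ; +-homo = ι-+ ; *-homo = ι-* ; -‿homo = ι-neg ; 0-homo = refl ; 1-homo = refl }

  ι-≟ : (a b : ℤ) → Maybe (ι a ≈ ι b)
  ι-≟ a b with a ℤ.≟ b
  ... | yes ≡.refl = just refl
  ... | no _       = nothing

  open RingSolver ℤ.+-*-rawRing (fromCommutativeRing seriesRing) ι-hom ι-≟ public

  one : ∀ {n} → Polynomial n
  one = con 1ℤ

-- The substitutions q ↦ -q and q ↦ q² as ring endomorphisms

module Substitution where
  open PowerSeries

  record IsEndo (h : Series → Series) : Set where
    field
      hom-cong : ∀ {f g} → f ≈ g → h f ≈ h g
      hom-+ : ∀ f g → h (f + g) ≈ h f + h g
      hom-* : ∀ f g → h (f * g) ≈ h f * h g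
      hom-neg : ∀ f → h (- f) ≈ - h f
      hom-ι : ∀ c → h (ι c) ≈ ι c

    hom-1 : h 1# ≈ 1#
    hom-1 = hom-ι 1ℤ

    hom-^ : ∀ f n → h (f ^ n) ≈ h f ^ n
    hom-^ f zero    = hom-1
    hom-^ f (suc n) = trans (hom-* f (f ^ n)) (*-congˡ (hom-^ f n))

    hom-1- : ∀ f → h (1# - f) ≈ 1# - h f
    hom-1- f = trans (hom-+ 1# (- f)) (+-cong hom-1 (hom-neg f))

  opaque
    unfolding _∙_

    σ-cong : ∀ {f g : Series} → (∀ i → f i ≡ g i) → ∀ n → σ f n ≡ σ g n
    σ-cong e zero    = e 0
    σ-cong e (suc n) = cong ℤ.-_ (σ-cong (λ i → e (suc i)) n)

    σ-⊕ : ∀ f g n → σ (f ⊕ g) n ≡ (σ f ⊕ σ g) n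
    σ-⊕ f g zero    = ≡.refl
    σ-⊕ f g (suc n) = ≡.trans (cong ℤ.-_ (σ-⊕ (tail f) (tail g) n)) (ℤ.neg-distrib-+ (σ (tail f) n) _)

    σ-⊝ : ∀ f n → σ (⊝ f) n ≡ ℤ.- σ f n
    σ-⊝ f zero    = ≡.refl
    σ-⊝ f (suc n) = cong ℤ.-_ (σ-⊝ (tail f) n)

    σ-0 : ∀ n → σ (λ _ → 0ℤ) n ≡ 0ℤ
    σ-0 zero    = ≡.refl
    σ-0 (suc n) = cong ℤ.-_ (σ-0 n)

    σ-scale : ∀ c f n → σ (λ i → c ℤ.* f i) n ≡ c ℤ.* σ f n
    σ-scale c f zero    = ≡.refl
    σ-scale c f (suc n) = ≡.trans (cong ℤ.-_ (σ-scale c (tail f) n)) (ℤ.neg-distribʳ-* c _)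

    σ-∙ : ∀ f g n → σ (f ∙ g) n ≡ (σ f ∙ σ g) n
    σ-∙ f g zero    = ≡.refl
    σ-∙ f g (suc n) = begin
      ℤ.- σ (tail (f ∙ g)) n
        ≡⟨ cong ℤ.-_ (σ-⊕ f₀g (tail f ∙ g) n) ⟩
      ℤ.- (σ f₀g n ℤ.+ σ (tail f ∙ g) n)
        ≡⟨ cong₂ (λ x y → ℤ.- (x ℤ.+ y)) (σ-scale (f 0) (tail g) n) (σ-∙ (tail f) g n) ⟩
      ℤ.- (f 0 ℤ.* σ (tail g) n ℤ.+ (σ (tail f) ∙ σ g) n)
        ≡⟨ lemma (f 0) (σ (tail g) n) _ ⟩
      f 0 ℤ.* (ℤ.- σ (tail g) n) ℤ.+ ℤ.- 1ℤ ℤ.* (σ (tail f) ∙ σ g) n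
        -- The sign moves into the left factor because `tail (σ f)` is the negative of `σ (tail f)`.
        ≡⟨ cong (λ x → f 0 ℤ.* (ℤ.- σ (tail g) n) ℤ.+ x)
             (≡.trans (≡.sym (∙-scaleˡ (ℤ.- 1ℤ) (σ (tail f)) (σ g) n))
               (∙-local {g = σ g} n (λ i _ → ℤ.-1*i≡-i (σ (tail f) i)) (λ _ _ → ≡.refl))) ⟩
      (σ f ∙ σ g) (suc n) ∎
      where
      open ≡-Reasoning
      f₀g : Series
      f₀g i = f 0 ℤ.* tail g i
      lemma : ∀ a b c → ℤ.- (a ℤ.* b ℤ.+ c) ≡ a ℤ.* (ℤ.- b) ℤ.+ ℤ.- 1ℤ ℤ.* c
      lemma = ℤ-Tactic.solve-∀

    σ-isEndo : IsEndo σ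
    σ-isEndo = record
      { hom-cong = λ e → pointwise (σ-cong (coeff e))
      ; hom-+ = λ f g → pointwise (σ-⊕ f g)
      ; hom-* = λ f g → pointwise (σ-∙ f g)
      ; hom-neg = λ f → pointwise (σ-⊝ f)
      ; hom-ι = λ c → pointwise λ { zero → ≡.refl ; (suc n) → cong ℤ.-_ (σ-0 n) }
      }

    -- Index `n` of `δ f` looks at index n/2 of `f`, so one degree is gained: knowledge up to `N`
    -- suffices for `suc N`. This gain drives the induction in `dilation-eq⇒0`.
    δ-local : ∀ {f g : Series} N → (∀ i → i ℕ.≤ N → f i ≡ g i) → ∀ n → n ℕ.≤ suc N → δ f n ≡ δ g n
    δ-local N       e zero          _              = e 0 z≤n
    δ-local N       e (suc zero)    _              = ≡.refl
    δ-local (suc N) e (suc (suc n)) (s≤s (s≤s n≤N)) =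
      δ-local N (λ i i≤N → e (suc i) (s≤s i≤N)) n (ℕ.m≤n⇒m≤1+n n≤N)

    δ-⊕ : ∀ f g n → δ (f ⊕ g) n ≡ (δ f ⊕ δ g) n
    δ-⊕ f g zero          = ≡.refl
    δ-⊕ f g (suc zero)    = ≡.refl
    δ-⊕ f g (suc (suc n)) = δ-⊕ (tail f) (tail g) n

    δ-⊝ : ∀ f n → δ (⊝ f) n ≡ ℤ.- δ f n
    δ-⊝ f zero          = ≡.refl
    δ-⊝ f (suc zero)    = ≡.refl
    δ-⊝ f (suc (suc n)) = δ-⊝ (tail f) n

    δ-0 : ∀ n → δ (λ _ → 0ℤ) n ≡ 0ℤ
    δ-0 zero          = ≡.refl
    δ-0 (suc zero)    = ≡.refl
    δ-0 (suc (suc n)) = δ-0 n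

    δ-scale : ∀ c f n → δ (λ i → c ℤ.* f i) n ≡ c ℤ.* δ f n
    δ-scale c f zero          = ≡.refl
    δ-scale c f (suc zero)    = ≡.sym (ℤ.*-zeroʳ c)
    δ-scale c f (suc (suc n)) = δ-scale c (tail f) n

    δ-∙ : ∀ f g n → δ (f ∙ g) n ≡ (δ f ∙ δ g) n
    δ-∙ f g zero          = ≡.refl
    δ-∙ f g (suc zero)    = ≡.sym (cong (ℤ._+ 0ℤ) (ℤ.*-zeroʳ (f 0)))
    δ-∙ f g (suc (suc n)) = begin
      δ (tail (f ∙ g)) n
        ≡⟨ δ-⊕ f₀g (tail f ∙ g) n ⟩
      δ f₀g n ℤ.+ δ (tail f ∙ g) n
        -- The inserted zero is the contribution of the vanishing coefficient of `δ f` at 1.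
        ≡⟨ cong₂ ℤ._+_ (δ-scale (f 0) (tail g) n)
                       (≡.trans (δ-∙ (tail f) g n) (≡.sym (ℤ.+-identityˡ _))) ⟩
      (δ f ∙ δ g) (suc (suc n)) ∎
      where
      open ≡-Reasoning
      f₀g : Series
      f₀g i = f 0 ℤ.* tail g i

    δ-isEndo : IsEndo δ
    δ-isEndo = record
      { hom-cong = λ e → pointwise λ n → δ-local n (λ i _ → coeff e i) n (ℕ.n≤1+n n)
      ; hom-+ = λ f g → pointwise (δ-⊕ f g)
      ; hom-* = λ f g → pointwise (δ-∙ f g)
      ; hom-neg = λ f → pointwise (δ-⊝ f)
      ; hom-ι = λ c → pointwise λ { zero → ≡.refl ; (suc zero) → ≡.refl ; (suc (suc n)) → δ-0 n }
      }

    σδ : ∀ f → σ (δ f) ≈ δ f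
    σδ f = pointwise (go f)
      where
      go : ∀ f n → σ (δ f) n ≡ δ f n
      go f zero          = ≡.refl
      go f (suc zero)    = ≡.refl
      go f (suc (suc n)) = ≡.trans (ℤ.neg-involutive _) (go (tail f) n)

    δ-even : ∀ f n → δ f (n ℕ.* 2) ≡ f n
    δ-even f zero    = ≡.refl
    δ-even f (suc n) = δ-even (tail f) n

    δ-odd : ∀ f n → δ f (suc (n ℕ.* 2)) ≡ 0ℤ
    δ-odd f zero    = ≡.refl
    δ-odd f (suc n) = δ-odd (tail f) n

    σ-even : ∀ f n → σ f (n ℕ.* 2) ≡ f (n ℕ.* 2)
    σ-even f zero    = ≡.refl
    σ-even f (suc n) = ≡.trans (ℤ.neg-involutive _) (σ-even (tail (tail f)) n)

    σ-odd : ∀ f n → σ f (suc (n ℕ.* 2)) ≡ ℤ.- f (suc (n ℕ.* 2))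
    σ-odd f n = cong ℤ.-_ (σ-even (tail f) n)

    δ-head : ∀ f → δ f 0 ≡ f 0
    δ-head f = ≡.refl

    σ-head : ∀ f → σ f 0 ≡ f 0
    σ-head f = ≡.refl

    ι-head : ∀ c → ι c 0 ≡ c
    ι-head c = ≡.refl

    q^-zero : ∀ i f → (q^ (suc i) * f) 0 ≡ 0ℤ
    q^-zero i f = ≡.refl

    q^-suc : ∀ i f n → (q^ (suc i) * f) (suc n) ≡ (q^ i * f) n
    q^-suc i f n = ℤ.+-identityˡ _

    q^-below : ∀ i f n → n ℕ.< i → (q^ i * f) n ≡ 0ℤ
    q^-below (suc i) f zero    _         = q^-zero i f
    q^-below (suc i) f (suc n) (s≤s n<i) = ≡.trans (q^-suc i f n) (q^-below i f n n<i)

  q^-+ : ∀ i j → q^ (i ℕ.+ j) ≈ q^ i * q^ j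
  q^-+ zero    j = trans (sym (*-identityˡ (q^ j))) (*-congʳ (pointwise ι1-coeff))
  q^-+ (suc i) j = pointwise λ
    { zero    → ≡.sym (q^-zero i (q^ j))
    ; (suc n) → ≡.trans (coeff (q^-+ i j) n) (≡.sym (q^-suc i (q^ j) n)) }

  q^-* : ∀ i j → q^ (i ℕ.* j) ≈ q^ j ^ i
  q^-* zero    j = sym (pointwise ι1-coeff)
  q^-* (suc i) j = trans (q^-+ j (i ℕ.* j)) (*-congˡ (q^-* i j))

  opaque
    unfolding _∙_
    δq : δ (q^ 1) ≈ q^ 2
    δq = pointwise λ
      { zero                      → ≡.refl
      ; (suc zero)                → ≡.refl
      ; (suc (suc zero))          → ≡.refl
      ; (suc (suc (suc zero)))    → ≡.refl
      ; (suc (suc (suc (suc n)))) → δ-0 n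
      }

    σq : σ (q^ 1) ≈ - q^ 1
    σq = pointwise λ
      { zero          → ≡.refl
      ; (suc zero)    → ≡.refl
      ; (suc (suc n)) → ≡.trans (ℤ.neg-involutive _) (σ-0 n)
      }

  module σ = IsEndo σ-isEndo
  module δ = IsEndo δ-isEndo

-- Euler's product, Gauss's theta series and their dissections

module Products where
  open PowerSeries
  open Substitution
  open import Algebra.Properties.Ring ring using (-‿distribˡ-*)
  open import Relation.Binary.Reasoning.Setoid setoid

  infix 4 _≈[_]_

  -- Congruence modulo q^(N+1). Identities between infinite products and sums are proved for finite
  -- truncations and reach the limit through this relation.
  _≈[_]_ : Series → ℕ → Series → Set
  f ≈[ N ] g = ∀ n → n ℕ.≤ N → f n ≡ g n

  *-cong[] : ∀ {N f f′ g g′} → f ≈[ N ] f′ → g ≈[ N ] g′ → f * g ≈[ N ] f′ * g′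
  *-cong[] ff gg n n≤N = ∙-local n (λ i i≤n → ff i (ℕ.≤-trans i≤n n≤N)) (λ i i≤n → gg i (ℕ.≤-trans i≤n n≤N))

  +-cong[] : ∀ {N f f′ g g′} → f ≈[ N ] f′ → g ≈[ N ] g′ → f + g ≈[ N ] f′ + g′
  +-cong[] {f = f} {f′} {g} {g′} ff gg n n≤N =
    ≡.trans (⊕-coeff f g n) (≡.trans (cong₂ ℤ._+_ (ff n n≤N) (gg n n≤N)) (≡.sym (⊕-coeff f′ g′ n)))

  ^-cong[] : ∀ {N f f′} j → f ≈[ N ] f′ → f ^ j ≈[ N ] f′ ^ j
  ^-cong[] zero    ff n n≤N = ≡.refl
  ^-cong[] (suc j) ff = *-cong[] ff (^-cong[] j ff)

  δ-cong[] : ∀ {N f g} → f ≈[ N ] g → δ f ≈[ N ] δ g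
  δ-cong[] {N} e n n≤N = δ-local N e n (ℕ.m≤n⇒m≤1+n n≤N)

  opaque
    unfolding _∙_

    σ-local : ∀ {f g : Series} n → (∀ i → i ℕ.≤ n → f i ≡ g i) → σ f n ≡ σ g n
    σ-local zero    e = e 0 z≤n
    σ-local (suc n) e = cong ℤ.-_ (σ-local n (λ i i≤n → e (suc i) (s≤s i≤n)))

    ⋆≈* : ∀ f g → f ⋆ g ≈ f * g
    ⋆≈* f g = refl

    ⊖≈- : ∀ f g → f ⊖ g ≈ f - g
    ⊖≈- f g = refl

  ⋆^≈^ : ∀ f j → f ⋆^ j ≈ f ^ j
  ⋆^≈^ f zero    = sym (pointwise ι1-coeff)
  ⋆^≈^ f (suc j) = trans (⋆≈* f (f ⋆^ j)) (*-congˡ (⋆^≈^ f j))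

  σ-cong[] : ∀ {N f g} → f ≈[ N ] g → σ f ≈[ N ] σ g
  σ-cong[] e n n≤N = σ-local n (λ i i≤n → e i (ℕ.≤-trans i≤n n≤N))

  δq^ : ∀ n → δ (q^ n) ≈ q^ n * q^ n
  δq^ zero    = trans (δ.hom-cong (sym (pointwise ι1-coeff)))
    (trans δ.hom-1 (trans (sym (*-identityˡ 1#)) (*-cong (pointwise ι1-coeff) (pointwise ι1-coeff))))
  δq^ (suc n) = begin
    δ (q^ (suc n))                 ≈⟨ δ.hom-cong (q^-+ 1 n) ⟩
    δ (q^ 1 * q^ n)                ≈⟨ δ.hom-* (q^ 1) (q^ n) ⟩
    δ (q^ 1) * δ (q^ n)            ≈⟨ *-cong (trans δq (q^-+ 1 1)) (δq^ n) ⟩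
    q^ 1 * q^ 1 * (q^ n * q^ n)    ≈⟨ solve 2 (λ x y → x :* x :* (y :* y) := x :* y :* (x :* y))
        refl (q^ 1) (q^ n) ⟩
    q^ 1 * q^ n * (q^ 1 * q^ n)    ≈⟨ sym (*-cong (q^-+ 1 n) (q^-+ 1 n)) ⟩
    q^ (suc n) * q^ (suc n) ∎

  infix 9 1-q^_ 1+q^_

  1-q^_ 1+q^_ : ℕ → Series
  1-q^ i = 1# - q^ i
  1+q^ i = 1# + q^ i

  -- P n = ∏_{i=1}^n (1 - q^i), D n = ∏_{i=1}^n (1 + q^i), W s d = ∏_{i=1}^d (1 - q^{s+i})

  P D : ℕ → Series
  P zero    = 1#
  P (suc n) = 1-q^ suc n * P n
  D zero    = 1#
  D (suc n) = 1+q^ suc n * D n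

  W : ℕ → ℕ → Series
  W s zero    = 1#
  W s (suc d) = 1-q^ (s ℕ.+ suc d) * W s d

  partialProduct≈P^ : ∀ j n → partialProduct j n ≈ P n ^ j
  partialProduct≈P^ j zero    = sym (trans (1^ j) (pointwise ι1-coeff))
    where
    1^ : ∀ j → 1# ^ j ≈ 1#
    1^ zero    = refl
    1^ (suc j) = trans (*-identityˡ _) (1^ j)
  partialProduct≈P^ j (suc n) = begin
    ((q^ 0 ⊖ q^ (suc n)) ⋆^ j) ⋆ partialProduct j n ≈⟨ ⋆≈* _ _ ⟩
    ((q^ 0 ⊖ q^ (suc n)) ⋆^ j) * partialProduct j n
      ≈⟨ *-cong (trans (⋆^≈^ _ j) (^-congˡ j (trans (⊖≈- _ _) (+-congʳ (sym (pointwise ι1-coeff)))))) (partialProduct≈P^ j n) ⟩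
    (1-q^ suc n) ^ j * P n ^ j ≈⟨ sym (^-distrib-* _ (P n) j) ⟩
    P (suc n) ^ j ∎

  E : Series
  E = p 1

  P≈E : ∀ N → P N ≈[ N ] E
  P≈E N n n≤N = ≡.trans
    (≡.sym (coeff (trans (partialProduct≈P^ 1 N) (*-identityʳ (P N))) n))
    (p-stable 1 n N n≤N)

  p≈E^ : ∀ j → p j ≈ E ^ j
  p≈E^ j = pointwise λ n → ≡.trans (coeff (partialProduct≈P^ j n) n) (^-cong[] j (P≈E n) n ℕ.≤-refl)

  -- Shanks' finite form of Gauss's identity: θ-sum n * D n = P n + 2 U n n, where
  -- U n n is divisible by q^(n+1).

  W-head : ∀ s d → W s (suc d) ≈ 1-q^ suc s * W (suc s) d
  W-head s zero    rewrite ℕ.+-comm s 1 = refl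
  W-head s (suc d) = begin
    1-q^ (s ℕ.+ suc (suc d)) * W s (suc d)
      ≡⟨ cong (λ i → 1-q^ i * W s (suc d)) (ℕ.+-suc s (suc d)) ⟩
    1-q^ (suc s ℕ.+ suc d) * W s (suc d)
      ≈⟨ *-congˡ (W-head s d) ⟩
    1-q^ (suc s ℕ.+ suc d) * (1-q^ suc s * W (suc s) d)
      ≈⟨ solve 3 (λ a b c → a :* (b :* c) := b :* (a :* c))
          refl (1-q^ (suc s ℕ.+ suc d)) (1-q^ suc s) (W (suc s) d) ⟩
    1-q^ suc s * W (suc s) (suc d) ∎

  P≈W : ∀ n → P n ≈ W 0 n
  P≈W zero    = refl
  P≈W (suc n) = *-congˡ (P≈W n)

  2# : Series
  2# = ι (+ 2)

  -- The n-th summand is (-1)^n q^(n²) written as one power; the factor 2 accounts for the indices n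
  -- and -n.
  θ-sum : ℕ → Series
  θ-sum zero    = 1#
  θ-sum (suc n) = θ-sum n + 2# * (- q^ (suc n)) ^ suc n

  -- For s < n the factor `W` is the quotient of `P n` by `P (suc s)`, written as a product so that
  -- no division occurs.
  term : ℕ → ℕ → Series
  term n s = (- q^ (suc n)) ^ suc s * (W (suc s) (n ℕ.∸ suc s) * D s)

  U : ℕ → ℕ → Series
  U n zero    = 0#
  U n (suc s) = U n s + term n s

  [-q^]^ : ∀ n s → (- q^ (suc n)) ^ s ≈ (- q^ n) ^ s * q^ s
  [-q^]^ n s = begin
    (- q^ (suc n)) ^ s ≈⟨ ^-congˡ s (trans (-‿cong (trans (q^-+ 1 n) (*-comm (q^ 1) (q^ n)))) (-‿distribˡ-* (q^ n) (q^ 1))) ⟩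
    (- q^ n * q^ 1) ^ s ≈⟨ ^-distrib-* (- q^ n) (q^ 1) s ⟩
    (- q^ n) ^ s * q^ 1 ^ s ≈⟨ *-congˡ (sym (q^-* s 1)) ⟩
    (- q^ n) ^ s * q^ (s ℕ.* 1) ≡⟨ cong (λ i → (- q^ n) ^ s * q^ i) (ℕ.*-identityʳ s) ⟩
    (- q^ n) ^ s * q^ s ∎

  -- Including one more term on both levels changes the residue on the right into one of the same
  -- shape with `s` advanced by one. At s = n the product `W` is empty and the residue is the new
  -- theta summand times `D n`. The complement `d` makes the truncated subtraction in `term` exact.
  telescope : ∀ s d n → s ℕ.+ d ≡ n →
    (2# * U (suc n) s + P (suc n)) - 1+q^ suc n * (2# * U n s + P n)
      ≈ 2# * ((- q^ (suc n)) ^ suc s * (W s d * D s))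
  telescope zero d .d ≡.refl = begin
    (2# * 0# + P (suc d)) - 1+q^ suc d * (2# * 0# + P d)
      ≈⟨ +-cong (+-cong (zeroʳ 2#) refl) (-‿cong (*-congˡ (+-congʳ (zeroʳ 2#)))) ⟩
    (0# + 1-q^ suc d * P d) - 1+q^ suc d * (0# + P d)
      ≈⟨ +-cong (+-identityˡ _) (-‿cong (*-congˡ (+-identityˡ _))) ⟩
    1-q^ suc d * P d - 1+q^ suc d * P d
      ≈⟨ +-cong (*-congˡ (P≈W d)) (-‿cong (*-congˡ (P≈W d))) ⟩
    1-q^ suc d * W 0 d - 1+q^ suc d * W 0 d
      ≈⟨ solve 2 (λ x w → (one :- x) :* w :- (one :+ x) :* w := con (+ 2) :* (:- x :* w))
          refl (q^ (suc d)) (W 0 d) ⟩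
    2# * ((- q^ (suc d)) * W 0 d)
      ≈⟨ *-congˡ (*-cong (sym (*-identityʳ _)) (sym (*-identityʳ _))) ⟩
    2# * ((- q^ (suc d)) ^ 1 * (W 0 d * D 0)) ∎
  telescope (suc s) d .(suc s ℕ.+ d) ≡.refl = begin
    (2# * (a + term (suc n) s) + P (suc n)) - 1+q^ suc n * (2# * (b + term n s) + P n)
      ≈⟨ +-cong (+-congʳ (*-congˡ (+-congˡ T₁))) (-‿cong (*-congˡ (+-congʳ (*-congˡ (+-congˡ T₀))))) ⟩
    (2# * (a + y * r * ((1# - Q) * w * D s)) + P (suc n)) - (1# + Q) * (2# * (b + y * (w * D s)) + P n)
      ≈⟨ solve 9 (λ a b y r Q w D P′ P →
            (con (+ 2) :* (a :+ y :* r :* ((one :- Q) :* w :* D)) :+ P′)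
              :- (one :+ Q) :* (con (+ 2) :* (b :+ y :* (w :* D)) :+ P)
         := ((con (+ 2) :* a :+ P′) :- (one :+ Q) :* (con (+ 2) :* b :+ P))
             :+ con (+ 2) :* y :* w :* D :* (r :* (one :- Q) :- (one :+ Q))) refl
            a b y r Q w (D s) (P (suc n)) (P n) ⟩
    ((2# * a + P (suc n)) - 1+q^ suc n * (2# * b + P n)) + 2# * y * w * D s * (r * (1# - Q) - (1# + Q))
      ≈⟨ +-congʳ (telescope s (suc d) n (ℕ.+-suc s d)) ⟩
    2# * (y * (W s (suc d) * D s)) + 2# * y * w * D s * (r * (1# - Q) - (1# + Q))
      ≈⟨ +-congʳ (*-congˡ (*-congˡ (*-congʳ (W-head s d)))) ⟩
    2# * (y * ((1# - r) * w * D s)) + 2# * y * w * D s * (r * (1# - Q) - (1# + Q))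
      ≈⟨ solve 5 (λ y r Q w D →
            con (+ 2) :* (y :* ((one :- r) :* w :* D)) :+ con (+ 2) :* y :* w :* D :* (r :* (one :- Q) :- (one :+ Q))
         := con (+ 2) :* ((:- Q :* y) :* (w :* ((one :+ r) :* D)))) refl
            y r Q w (D s) ⟩
    2# * ((- q^ (suc n)) ^ suc (suc s) * (W (suc s) d * D (suc s))) ∎
    where
    n = suc s ℕ.+ d
    a = U (suc n) s
    b = U n s
    y = (- q^ (suc n)) ^ suc s
    r = q^ (suc s)
    Q = q^ (suc n)
    w = W (suc s) d
    T₀ : term n s ≈ y * (w * D s)
    T₀ rewrite ℕ.m+n∸m≡n s d = refl
    T₁ : term (suc n) s ≈ y * r * ((1# - Q) * w * D s)
    T₁ = *-cong ([-q^]^ (suc n) (suc s))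
      (*-congʳ (reflexive (≡.trans (cong (W (suc s)) (≡.trans (cong (ℕ._∸ s) (≡.sym (ℕ.+-suc s d))) (ℕ.m+n∸m≡n s (suc d))))
         (cong (λ i → (1-q^ i) * w) (ℕ.+-suc (suc s) d)))))

  θ-sum-product : ∀ n → θ-sum n * D n ≈ 2# * U n n + P n
  θ-sum-product zero    = solve 0 (one :* one := con (+ 2) :* con 0ℤ :+ one) refl
  θ-sum-product (suc n) = begin
    (θ-sum n + 2# * y) * ((1# + Q) * D n)
      ≈⟨ solve 4 (λ t y Q D → (t :+ con (+ 2) :* y) :* ((one :+ Q) :* D)
                    := (one :+ Q) :* (t :* D) :+ con (+ 2) :* (y :* (one :* D)) :+ con (+ 2) :* (y :* Q :* (one :* D)))
           refl (θ-sum n) y Q (D n) ⟩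
    (1# + Q) * (θ-sum n * D n) + 2# * (y * (1# * D n)) + 2# * (y * Q * (1# * D n))
      -- The middle summand is the telescoped residue at s = n; the remaining one will be the last
      -- term of `U (suc n) (suc n)`.
      ≈⟨ +-congʳ (+-cong (*-congˡ (θ-sum-product n)) (sym (telescope n 0 n (ℕ.+-identityʳ n)))) ⟩
    (1# + Q) * (2# * U n n + P n)
      + ((2# * U (suc n) n + P (suc n)) - (1# + Q) * (2# * U n n + P n))
      + 2# * (y * Q * (1# * D n))
      ≈⟨ solve 4 (λ a b c d → a :+ (con (+ 2) :* b :+ c :- a) :+ con (+ 2) :* d := con (+ 2) :* (b :+ d) :+ c)
           refl ((1# + Q) * (2# * U n n + P n)) (U (suc n) n) (P (suc n)) (y * Q * (1# * D n)) ⟩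
    2# * (U (suc n) n + y * Q * (1# * D n)) + P (suc n)
      ≈⟨ +-congʳ (*-congˡ (+-congˡ (sym last))) ⟩
    2# * U (suc n) (suc n) + P (suc n) ∎
    where
    y = (- q^ (suc n)) ^ suc n
    Q = q^ (suc n)
    last : term (suc n) n ≈ y * Q * (1# * D n)
    last = *-cong ([-q^]^ (suc n) (suc n)) (*-congʳ (reflexive (cong (W (suc n)) (ℕ.n∸n≡0 n))))

  -- Factor by factor, (1 + q^i)(1 - q^i) = 1 - q^(2i); thus `D` is a finite form of E(q²)/E.
  D*P : ∀ n → D n * P n ≈ δ (P n)
  D*P zero    = trans (*-identityˡ 1#) (sym δ.hom-1)
  D*P (suc n) = begin
    (1# + Q) * D n * ((1# - Q) * P n)
      ≈⟨ solve 3 (λ Q D P → (one :+ Q) :* D :* ((one :- Q) :* P) := (one :- Q :* Q) :* (D :* P))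
          refl Q (D n) (P n) ⟩
    (1# - Q * Q) * (D n * P n)
      ≈⟨ *-cong (trans (+-congˡ (-‿cong (sym (δq^ (suc n))))) (sym (δ.hom-1- Q))) (D*P n) ⟩
    δ (1# - Q) * δ (P n)
      ≈⟨ sym (δ.hom-* _ _) ⟩
    δ (P (suc n)) ∎
    where
    Q = q^ (suc n)

  0[]-*ʳ : ∀ {N f} g → f ≈[ N ] 0# → f * g ≈[ N ] 0#
  0[]-*ʳ {f = f} g f≈0 n n≤N = ≡.trans (*-cong[] {g = g} f≈0 (λ _ _ → ≡.refl) n n≤N) (coeff (zeroˡ g) n)

  0[]-+ : ∀ {N f g} → f ≈[ N ] 0# → g ≈[ N ] 0# → f + g ≈[ N ] 0#
  0[]-+ f≈0 g≈0 n n≤N = ≡.trans (+-cong[] f≈0 g≈0 n n≤N) (coeff (+-identityˡ 0#) n)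

  [-q^]^≈0 : ∀ n s → (- q^ (suc n)) ^ suc s ≈[ n ] 0#
  [-q^]^≈0 n s i i≤n = ≡.trans
    (coeff (solve 2 (λ Q x → (:- Q) :* x := Q :* (:- x)) refl (q^ (suc n)) ((- q^ (suc n)) ^ s)) i)
    (≡.trans (q^-below (suc n) _ i (s≤s i≤n)) (≡.sym (ι0-coeff i)))

  U≈0 : ∀ n s → U n s ≈[ n ] 0#
  U≈0 n zero    _ _ = ≡.refl
  U≈0 n (suc s) = 0[]-+ (U≈0 n s) (0[]-*ʳ _ ([-q^]^≈0 n s))

  -- The diagonal reads off the limit, as `p` does for products: the summand with index `suc N` has
  -- no coefficient below q^(N+1).
  θ : Series
  θ n = θ-sum n n

  θ-sum≈θ : ∀ N → θ-sum N ≈[ N ] θ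
  θ-sum≈θ zero    .zero z≤n = ≡.refl
  θ-sum≈θ (suc N) n n≤1+N with ℕ.m≤n⇒m<n∨m≡n n≤1+N
  ... | inj₂ ≡.refl    = ≡.refl
  ... | inj₁ (s≤s n≤N) = ≡.trans
    (coeff (+-congˡ {θ-sum N} (*-comm 2# ((- q^ (suc N)) ^ suc N))) n)
    (≡.trans (+-cong[] {f = θ-sum N} (θ-sum≈θ N) (0[]-*ʳ 2# ([-q^]^≈0 N N)) n n≤N)
             (coeff (+-identityʳ θ) n))

  -- Multiplying the finite identity by `P n` turns `D n * P n` into `δ (P n)`, which avoids
  -- dividing by a series; the correction `U n n` has no coefficient up to degree `n`.
  gauss : θ * δ E ≈ E * E
  gauss = pointwise λ n → ≡.trans
    (≡.sym (*-cong[] (θ-sum≈θ n) (δ-cong[] (P≈E n)) n ℕ.≤-refl))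
    (≡.trans (coeff (finite n) n)
    (≡.trans (+-cong[] {n} {P n * P n} (*-cong[] (P≈E n) (P≈E n)) (0[]-*ʳ (2# * P n) (U≈0 n n)) n ℕ.≤-refl)
             (coeff (+-identityʳ (E * E)) n)))
    where
    finite : ∀ n → θ-sum n * δ (P n) ≈ P n * P n + U n n * (2# * P n)
    finite n = begin
      θ-sum n * δ (P n)             ≈⟨ *-congˡ (sym (D*P n)) ⟩
      θ-sum n * (D n * P n)         ≈⟨ sym (*-assoc _ _ _) ⟩
      θ-sum n * D n * P n           ≈⟨ *-congʳ (θ-sum-product n) ⟩
      (2# * U n n + P n) * P n
        ≈⟨ solve 2 (λ U P → (con (+ 2) :* U :+ P) :* P := P :* P :+ U :* (con (+ 2) :* P)) refl (U n n) (P n) ⟩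
      P n * P n + U n n * (2# * P n) ∎

  -- Splitting the theta series by the parity of its index

  square-^ : ∀ x n → x ^ (n ℕ.* 2) ≈ (x * x) ^ n
  square-^ x zero    = refl
  square-^ x (suc n) = trans (*-congˡ (*-congˡ (square-^ x n))) (sym (*-assoc x x _))

  q^-double : ∀ n → q^ (n ℕ.* 2) ≈ δ (q^ n)
  q^-double n = begin
    q^ (n ℕ.* 2)   ≈⟨ q^-* n 2 ⟩
    q^ 2 ^ n       ≈⟨ ^-congˡ n (q^-+ 1 1) ⟩
    (q^ 1 * q^ 1) ^ n ≈⟨ ^-distrib-* _ _ n ⟩
    q^ 1 ^ n * q^ 1 ^ n ≈⟨ *-cong q^1^ q^1^ ⟩
    q^ n * q^ n    ≈⟨ sym (δq^ n) ⟩
    δ (q^ n) ∎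
    where
    q^1^ : q^ 1 ^ n ≈ q^ n
    q^1^ = trans (sym (q^-* n 1)) (reflexive (cong q^ (ℕ.*-identityʳ n)))

  [-x]^even : ∀ x n → (- x) ^ (n ℕ.* 2) ≈ x ^ (n ℕ.* 2)
  [-x]^even x n = begin
    (- x) ^ (n ℕ.* 2)  ≈⟨ square-^ (- x) n ⟩
    (- x * - x) ^ n    ≈⟨ ^-congˡ n (solve 1 (λ x → (:- x) :* (:- x) := x :* x) refl x) ⟩
    (x * x) ^ n        ≈⟨ sym (square-^ x n) ⟩
    x ^ (n ℕ.* 2) ∎

  σq^-even : ∀ n → σ (q^ (n ℕ.* 2)) ≈ q^ (n ℕ.* 2)
  σq^-even n = trans (σ.hom-cong (q^-double n)) (trans (σδ _) (sym (q^-double n)))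

  σ-q^-odd : ∀ n → σ (- q^ (suc (n ℕ.* 2))) ≈ q^ (suc (n ℕ.* 2))
  σ-q^-odd n = begin
    σ (- q^ (suc (n ℕ.* 2)))         ≈⟨ σ.hom-neg _ ⟩
    - σ (q^ (suc (n ℕ.* 2)))         ≈⟨ -‿cong (σ.hom-cong (q^-+ 1 (n ℕ.* 2))) ⟩
    - σ (q^ 1 * q^ (n ℕ.* 2))        ≈⟨ -‿cong (σ.hom-* _ _) ⟩
    - (σ (q^ 1) * σ (q^ (n ℕ.* 2)))  ≈⟨ -‿cong (*-cong σq (σq^-even n)) ⟩
    - (- q^ 1 * q^ (n ℕ.* 2))        ≈⟨ solve 2 (λ x y → :- ((:- x) :* y) := x :* y) refl _ _ ⟩
    q^ 1 * q^ (n ℕ.* 2)              ≈⟨ sym (q^-+ 1 (n ℕ.* 2)) ⟩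
    q^ (suc (n ℕ.* 2)) ∎

  data Parity : ℕ → Set where
    even : ∀ n → Parity (n ℕ.* 2)
    odd  : ∀ n → Parity (suc (n ℕ.* 2))

  parity : ∀ n → Parity n
  parity zero = even 0
  parity (suc n) with parity n
  ... | even m = odd m
  ... | odd m  = even (suc m)

  θ-term : ℕ → Series
  θ-term n = (- q^ n) ^ n

  -- The integers n and n² have the same parity, so the sign produced by q ↦ -q cancels the one
  -- already present.
  σθ-term : ∀ n → σ (θ-term n) ≈ q^ n ^ n
  σθ-term n = trans (σ.hom-^ (- q^ n) n) (go (parity n))
    where
    go : ∀ {n} → Parity n → σ (- q^ n) ^ n ≈ q^ n ^ n
    go (even n) = trans (^-congˡ (n ℕ.* 2) (trans (σ.hom-neg _) (-‿cong (σq^-even n)))) ([-x]^even _ n)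
    go (odd n)  = ^-congˡ (suc (n ℕ.* 2)) (σ-q^-odd n)

  -- The exponent (2n)² is 4n², which is q^(n²) evaluated at q⁴; the inner `σ` removes the sign of
  -- the n-th summand.
  θ-term-even : ∀ n → θ-term (n ℕ.* 2) ≈ δ (δ (σ (θ-term n)))
  θ-term-even n = begin
    (- q^ (n ℕ.* 2)) ^ (n ℕ.* 2)  ≈⟨ [-x]^even _ n ⟩
    q^ (n ℕ.* 2) ^ (n ℕ.* 2)      ≈⟨ square-^ _ n ⟩
    (q^ (n ℕ.* 2) * q^ (n ℕ.* 2)) ^ n ≈⟨ ^-congˡ n (trans (sym (δq^ (n ℕ.* 2))) (δ.hom-cong (q^-double n))) ⟩
    δ (δ (q^ n)) ^ n              ≈⟨ sym (δ.hom-^ _ n) ⟩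
    δ (δ (q^ n) ^ n)              ≈⟨ δ.hom-cong (sym (δ.hom-^ _ n)) ⟩
    δ (δ (q^ n ^ n))              ≈⟨ δ.hom-cong (δ.hom-cong (sym (σθ-term n))) ⟩
    δ (δ (σ (θ-term n))) ∎

  θ-term-odd : ∀ n → θ-term (suc (n ℕ.* 2)) + σ (θ-term (suc (n ℕ.* 2))) ≈ 0#
  θ-term-odd n = begin
    (- x) ^ m + σ (θ-term m)                          ≈⟨ +-cong (*-congˡ ([-x]^even x n)) (σθ-term m) ⟩
    - x * x ^ (n ℕ.* 2) + x * x ^ (n ℕ.* 2) ≈⟨ solve 2 (λ x y → (:- x) :* y :+ x :* y := con 0ℤ)
        refl x (x ^ (n ℕ.* 2)) ⟩
    0# ∎
    where
    m = suc (n ℕ.* 2)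
    x = q^ m

  -- Odd indices have odd squares and cancel against their image under `σ`; even indices are counted
  -- twice.
  θ-dissection-finite : ∀ n → θ-sum (n ℕ.* 2) + σ (θ-sum (n ℕ.* 2)) ≈ 2# * δ (δ (σ (θ-sum n)))
  θ-dissection-finite zero    = begin
    1# + σ 1#              ≈⟨ +-congˡ σ.hom-1 ⟩
    1# + 1#                ≈⟨ solve 0 (one :+ one := con (+ 2) :* one) refl ⟩
    2# * 1#                ≈⟨ *-congˡ (sym (trans (δ.hom-cong (trans (δ.hom-cong σ.hom-1) δ.hom-1)) δ.hom-1)) ⟩
    2# * δ (δ (σ 1#)) ∎
  θ-dissection-finite (suc n) = begin
    a + 2# * b + 2# * c + σ (a + 2# * b + 2# * c)
      ≈⟨ +-congˡ (trans (step (a + 2# * b) c) (+-congʳ (step a b))) ⟩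
    a + 2# * b + 2# * c + (σ a + 2# * σ b + 2# * σ c)
      ≈⟨ solve 6 (λ a b c a′ b′ c′ → a :+ con (+ 2) :* b :+ con (+ 2) :* c :+ (a′ :+ con (+ 2) :* b′ :+ con (+ 2) :* c′)
                     := (a :+ a′) :+ con (+ 2) :* (b :+ b′) :+ con (+ 2) :* (c :+ c′))
                         refl a b c (σ a) (σ b) (σ c) ⟩
    (a + σ a) + 2# * (b + σ b) + 2# * (c + σ c)
      ≈⟨ +-cong (+-cong (θ-dissection-finite n) (*-congˡ (θ-term-odd n)))
                (*-congˡ (+-cong (θ-term-even (suc n)) (trans (σ.hom-cong (θ-term-even (suc n))) (σδ _)))) ⟩
    2# * S (θ-sum n) + 2# * 0# + 2# * (S (θ-term (suc n)) + S (θ-term (suc n)))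
      ≈⟨ solve 2 (λ x y → con (+ 2) :* x :+ con (+ 2) :* con 0ℤ :+ con (+ 2) :* (y :+ y) := con (+ 2) :* (x :+ con (+ 2) :* y))
           refl (S (θ-sum n)) (S (θ-term (suc n))) ⟩
    2# * (S (θ-sum n) + 2# * S (θ-term (suc n)))
      ≈⟨ *-congˡ (sym S-step) ⟩
    2# * S (θ-sum n + 2# * θ-term (suc n)) ∎
    where
    a = θ-sum (n ℕ.* 2)
    b = θ-term (suc (n ℕ.* 2))
    c = θ-term (suc n ℕ.* 2)
    S : Series → Series
    S f = δ (δ (σ f))
    step : ∀ f g → σ (f + 2# * g) ≈ σ f + 2# * σ g
    step f g = trans (σ.hom-+ f (2# * g)) (+-congˡ (trans (σ.hom-* 2# g) (*-congʳ (σ.hom-ι _))))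
    stepδ : ∀ f g → δ (f + 2# * g) ≈ δ f + 2# * δ g
    stepδ f g = trans (δ.hom-+ f (2# * g)) (+-congˡ (trans (δ.hom-* 2# g) (*-congʳ (δ.hom-ι _))))
    S-step : S (θ-sum n + 2# * θ-term (suc n)) ≈ S (θ-sum n) + 2# * S (θ-term (suc n))
    S-step = trans (δ.hom-cong (trans (δ.hom-cong (step _ _)) (stepδ _ _))) (stepδ _ _)

  n≤n*2 : ∀ n → n ℕ.≤ n ℕ.* 2
  n≤n*2 n = ℕ.m≤m*n n 2

  weaken[] : ∀ {M N f g} → M ℕ.≤ N → f ≈[ N ] g → f ≈[ M ] g
  weaken[] M≤N e n n≤M = e n (ℕ.≤-trans n≤M M≤N)

  θ-dissection : θ + σ θ ≈ 2# * δ (δ (σ θ))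
  θ-dissection = pointwise λ n →
    let e = weaken[] (n≤n*2 n) (θ-sum≈θ (n ℕ.* 2)) in ≡.trans
    (≡.sym (+-cong[] e (σ-cong[] e) n ℕ.≤-refl))
    (≡.trans (coeff (θ-dissection-finite n) n)
             (*-cong[] {f = 2#} (λ _ _ → ≡.refl) (δ-cong[] (δ-cong[] (σ-cong[] (θ-sum≈θ n)))) n ℕ.≤-refl))

  -- Under q ↦ -q the even factors stay and each odd factor 1 - z becomes 1 + z. The odd factors
  -- thus combine to 1 - z², with z² = q^(4i-2), and the product of these is E(q²)/E(q⁴). The
  -- statement clears that denominator.
  P-σP : ∀ n → P (n ℕ.* 2) * σ (P (n ℕ.* 2)) * δ (δ (P n)) ≈ δ (P (n ℕ.* 2)) * (δ (P n) * δ (P n))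
  P-σP zero    = begin
    1# * σ 1# * δ (δ 1#) ≈⟨ *-cong (*-congˡ σ.hom-1) (trans (δ.hom-cong δ.hom-1) δ.hom-1) ⟩
    1# * 1# * 1#         ≈⟨ *-assoc 1# 1# 1# ⟩
    1# * (1# * 1#)       ≈⟨ sym (*-cong δ.hom-1 (*-cong δ.hom-1 δ.hom-1)) ⟩
    δ 1# * (δ 1# * δ 1#) ∎
  P-σP (suc n) = begin
    P (suc n ℕ.* 2) * σ (P (suc n ℕ.* 2)) * δ (δ (P (suc n)))
      ≈⟨ *-cong (*-cong (*-congʳ (1-cong even-q)) σ-step) (trans (δ.hom-cong δ-step) (δ1-step (δ y) (δ (P n)))) ⟩
    (1# - y′) * ((1# - z) * Pₙ) * ((1# - y′) * ((1# + z) * σ Pₙ)) * ((1# - y″) * δ (δ (P n)))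
      ≈⟨ solve 6 (λ y′ y″ z Pₙ p′ r →
             (one :- y′) :* ((one :- z) :* Pₙ) :* ((one :- y′) :* ((one :+ z) :* p′)) :* ((one :- y″) :* r)
          := (one :- y′) :* (one :- y′) :* (one :- z :* z) :* (one :- y″) :* (Pₙ :* p′ :* r))
          refl y′ y″ z Pₙ (σ Pₙ) (δ (δ (P n))) ⟩
    (1# - y′) * (1# - y′) * (1# - z * z) * (1# - y″) * (Pₙ * σ Pₙ * δ (δ (P n)))
      ≈⟨ *-congˡ (P-σP n) ⟩
    (1# - y′) * (1# - y′) * (1# - z * z) * (1# - y″) * (δ Pₙ * (δ (P n) * δ (P n)))
      ≈⟨ solve 5 (λ y′ y″ z² Pₙ r →
            (one :- y′) :* (one :- y′) :* (one :- z²) :* (one :- y″) :* (Pₙ :* (r :* r))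
          := (one :- y″) :* ((one :- z²) :* Pₙ) :* ((one :- y′) :* r :* ((one :- y′) :* r)))
          refl y′ y″ (z * z) (δ Pₙ) (δ (P n)) ⟩
    (1# - y″) * ((1# - z * z) * δ Pₙ) * ((1# - y′) * δ (P n) * ((1# - y′) * δ (P n)))
      ≈⟨ sym (*-cong (trans (δ1-step _ _) (*-cong (1-cong (δ.hom-cong even-q)) (trans (δ1-step _ _) (*-congʳ (1-cong (δq^ _))))))
                     (*-cong δ-step δ-step)) ⟩
    δ (P (suc n ℕ.* 2)) * (δ (P (suc n)) * δ (P (suc n))) ∎
    where
    Pₙ = P (n ℕ.* 2)
    y = q^ (suc n)
    y′ = δ y
    y″ = δ (δ y)
    z = q^ (suc (n ℕ.* 2))
    1-cong : ∀ {f g} → f ≈ g → 1# - f ≈ 1# - g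
    1-cong e = +-congˡ (-‿cong e)
    even-q : q^ (suc n ℕ.* 2) ≈ y′
    even-q = q^-double (suc n)
    δ1-step : ∀ f g → δ ((1# - f) * g) ≈ (1# - δ f) * δ g
    δ1-step f g = trans (δ.hom-* _ _) (*-congʳ (δ.hom-1- f))
    δ-step : δ (P (suc n)) ≈ (1# - y′) * δ (P n)
    δ-step = δ1-step y (P n)
    σ-step : σ (P (suc n ℕ.* 2)) ≈ (1# - y′) * ((1# + z) * σ Pₙ)
    σ-step = begin
      σ ((1# - q^ (suc n ℕ.* 2)) * ((1# - z) * Pₙ))
        ≈⟨ trans (σ.hom-* _ _) (*-cong (σ.hom-1- _) (σ.hom-* _ _)) ⟩
      (1# - σ (q^ (suc n ℕ.* 2))) * (σ (1# - z) * σ Pₙ)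
        ≈⟨ *-cong (1-cong (trans (σq^-even (suc n)) even-q))
             (*-congʳ (trans (σ.hom-+ 1# (- z)) (+-cong σ.hom-1 (σ-q^-odd n)))) ⟩
      (1# - y′) * ((1# + z) * σ Pₙ) ∎

  E-σE : E * σ E * δ (δ E) ≈ δ E * (δ E * δ E)
  E-σE = pointwise λ n →
    let e = weaken[] (n≤n*2 n) (P≈E (n ℕ.* 2)) in ≡.trans
    (≡.sym (*-cong[] (*-cong[] e (σ-cong[] e)) (δ-cong[] (δ-cong[] (P≈E n))) n ℕ.≤-refl))
    (≡.trans (coeff (P-σP n) n)
      (*-cong[] (δ-cong[] e) (*-cong[] (δ-cong[] (P≈E n)) (δ-cong[] (P≈E n))) n ℕ.≤-refl))

-- Uniqueness for dilation equations and theta identities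

module Jacobi where
  open PowerSeries
  open Substitution
  open Products
  open import Algebra.Properties.Group +-group using ()
    renaming (x∙y⁻¹≈ε⇒x≈y to x-y≈0⇒x≈y; x≈y⇒x∙y⁻¹≈ε to x≈y⇒x-y≈0)
  open import Algebra.Properties.Ring ring using (x[y-z]≈xy-xz)
  open import Relation.Binary.Reasoning.Setoid setoid

  *≡0⇒≡0 : ∀ {i} j → i ≢ 0ℤ → i ℤ.* j ≡ 0ℤ → j ≡ 0ℤ
  *≡0⇒≡0 {i} j i≢0 ij≡0 with ℤ.i*j≡0⇒i≡0∨j≡0 i ij≡0
  ... | inj₁ i≡0 = contradiction i≡0 i≢0
  ... | inj₂ j≡0 = j≡0

  -- For n > 0 the coefficients of δ f up to n only involve those of f below n.

  dilation-eq⇒0 : ∀ {f} c b → c 0 ≢ 0ℤ → c 0 ≢ b 0 → c * f ≈ b * δ f → f ≈ 0#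
  dilation-eq⇒0 {f} c b c₀≢0 c₀≢b₀ eq = pointwise λ n → vanish n n ℕ.≤-refl
    where
    head : (c 0 ℤ.- b 0) ℤ.* f 0 ≡ 0ℤ
    head = ≡.trans (ℤ.*-distribʳ-+ (f 0) (c 0) (ℤ.- b 0))
      (≡.trans (cong₂ ℤ._+_ (≡.trans (≡.sym (∙-zero c f)) (≡.trans (coeff eq 0) (≡.trans (∙-zero b (δ f)) (cong (b 0 ℤ.*_) (δ-head f)))))
                            (≡.sym (ℤ.neg-distribˡ-* (b 0) (f 0))))
               (ℤ.+-inverseʳ (b 0 ℤ.* f 0)))

    step : ∀ N → f ≈[ N ] 0# → f (suc N) ≡ 0ℤ
    step N f≈0 = *≡0⇒≡0 (f (suc N)) c₀≢0 (≡.trans (≡.sym lhs) (≡.trans (coeff eq (suc N)) rhs))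
      where
      lhs : (c * f) (suc N) ≡ c 0 ℤ.* f (suc N)
      lhs = ≡.trans (∙-suc c f N) (≡.trans
        (cong (λ x → c 0 ℤ.* f (suc N) ℤ.+ x)
          (≡.trans (*-cong[] {f = tail c} (λ _ _ → ≡.refl) f≈0 N ℕ.≤-refl)
                   (≡.trans (coeff (zeroʳ (tail c)) N) (ι0-coeff N))))
        (ℤ.+-identityʳ _))
      rhs : (b * δ f) (suc N) ≡ 0ℤ
      rhs = ≡.trans (*-cong[] {f = b} (λ _ _ → ≡.refl) (δ-local N f≈0) (suc N) ℕ.≤-refl)
        (≡.trans (coeff (trans (*-congˡ (δ.hom-ι 0ℤ)) (zeroʳ b)) (suc N)) (ι0-coeff (suc N)))

    vanish : ∀ N → f ≈[ N ] 0#
    vanish zero    .zero z≤n = ≡.trans (*≡0⇒≡0 (f 0) (λ e → c₀≢b₀ (ℤ.i-j≡0⇒i≡j (c 0) (b 0) e)) head) (≡.sym (ι0-coeff 0))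
    vanish (suc N) n n≤1+N with ℕ.m≤n⇒m<n∨m≡n n≤1+N
    ... | inj₁ (s≤s n≤N) = vanish N n n≤N
    ... | inj₂ ≡.refl    = ≡.trans (step N (vanish N)) (≡.sym (ι0-coeff (suc N)))

  -- With `b = 0#` the dilation argument shows that a series with nonzero constant term is not a
  -- zero divisor.
  *-cancelˡ : ∀ a {f g} → a 0 ≢ 0ℤ → a * f ≈ a * g → f ≈ g
  *-cancelˡ a {f} {g} a₀≢0 eq = x-y≈0⇒x≈y f g
    (dilation-eq⇒0 a 0# a₀≢0 (λ e → a₀≢0 (≡.trans e (ι0-coeff 0))) (begin
      a * (f - g)      ≈⟨ solve 3 (λ a f g → a :* (f :- g) := a :* f :- a :* g) refl a f g ⟩
      a * f - a * g    ≈⟨ x≈y⇒x-y≈0 eq ⟩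
      0#               ≈⟨ sym (zeroˡ _) ⟩
      0# * δ (f - g) ∎))

  Monic : Series → Set
  Monic f = f 0 ≡ 1ℤ

  monic⇒≢0 : ∀ {f} → Monic f → f 0 ≢ 0ℤ
  monic⇒≢0 {f} e e′ with ≡.trans (≡.sym e) e′
  ... | ()

  *-monic : ∀ {f g} → Monic f → Monic g → Monic (f * g)
  *-monic {f} {g} e e′ = ≡.trans (∙-zero f g) (cong₂ ℤ._*_ e e′)

  ^-monic : ∀ {f} n → Monic f → Monic (f ^ n)
  ^-monic zero    e = ι1-coeff 0
  ^-monic (suc n) e = *-monic e (^-monic n e)

  δ-monic : ∀ {f} → Monic f → Monic (δ f)
  δ-monic {f} = ≡.trans (δ-head f)

  E-monic : Monic E
  E-monic = ≡.refl

  private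
    E₂ E₄ E₈ : Series
    E₂ = δ E
    E₄ = δ E₂
    E₈ = δ E₄

    E₂-monic : Monic E₂
    E₂-monic = δ-monic E-monic

    E₄-monic : Monic E₄
    E₄-monic = δ-monic E₂-monic

    θ̂ : Series
    θ̂ = σ θ

  gauss-σ : σ θ * δ E ≈ σ E * σ E
  gauss-σ = begin
    σ θ * δ E     ≈⟨ *-congˡ (sym (σδ E)) ⟩
    σ θ * σ (δ E) ≈⟨ sym (σ.hom-* θ (δ E)) ⟩
    σ (θ * δ E)   ≈⟨ σ.hom-cong gauss ⟩
    σ (E * E)     ≈⟨ σ.hom-* E E ⟩
    σ E * σ E ∎

  δ-eq : ∀ {a b c d} → a * b ≈ c * d → δ a * δ b ≈ δ c * δ d
  δ-eq eq = trans (sym (δ.hom-* _ _)) (trans (δ.hom-cong eq) (δ.hom-* _ _))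

  -- Multiplied by E₂² E₄², both sides become E₂⁶: the left one by Gauss and `E-σE`, the right one
  -- by the image of `gauss` under `δ`.
  θ*θ̂ : θ * σ θ ≈ δ θ * δ θ
  θ*θ̂ = *-cancelˡ (E₂ * E₂ * (E₄ * E₄))
    (monic⇒≢0 {E₂ * E₂ * (E₄ * E₄)} (*-monic (*-monic E₂-monic E₂-monic) (*-monic E₄-monic E₄-monic))) (begin
    E₂ * E₂ * (E₄ * E₄) * (θ * θ̂)
      ≈⟨ solve 4 (λ a b g h → a :* a :* (b :* b) :* (g :* h) := g :* a :* (h :* a) :* (b :* b))
          refl E₂ E₄ θ θ̂ ⟩
    θ * E₂ * (θ̂ * E₂) * (E₄ * E₄)
      ≈⟨ *-congʳ (*-cong gauss gauss-σ) ⟩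
    E * E * (σ E * σ E) * (E₄ * E₄)
      ≈⟨ solve 3 (λ a b c → a :* a :* (b :* b) :* (c :* c) := a :* b :* c :* (a :* b :* c)) refl E (σ E) E₄ ⟩
    E * σ E * E₄ * (E * σ E * E₄)
      ≈⟨ *-cong E-σE E-σE ⟩
    E₂ * (E₂ * E₂) * (E₂ * (E₂ * E₂))
      ≈⟨ solve 1 (λ a → a :* (a :* a) :* (a :* (a :* a)) := a :* a :* (a :* a :* (a :* a))) refl E₂ ⟩
    E₂ * E₂ * (E₂ * E₂ * (E₂ * E₂))
      ≈⟨ *-congˡ (sym (*-cong (δ-eq gauss) (δ-eq gauss))) ⟩
    E₂ * E₂ * (δ θ * E₄ * (δ θ * E₄))
      ≈⟨ solve 3 (λ a b g → a :* a :* (g :* b :* (g :* b)) := a :* a :* (b :* b) :* (g :* g)) refl E₂ E₄ (δ θ) ⟩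
    E₂ * E₂ * (E₄ * E₄) * (δ θ * δ θ) ∎)

  δ[θ²-defect] : ∀ f g → δ (f * f + g * g - 2# * (δ g * δ g)) ≈ δ f * δ f + δ g * δ g - 2# * (δ (δ g) * δ (δ g))
  δ[θ²-defect] f g = begin
    δ (f * f + g * g - 2# * (δ g * δ g))
      ≈⟨ trans (δ.hom-+ _ _) (+-cong (δ.hom-+ _ _) (δ.hom-neg _)) ⟩
    δ (f * f) + δ (g * g) - δ (2# * (δ g * δ g))
      ≈⟨ +-cong (+-cong (δ.hom-* f f) (δ.hom-* g g))
                (-‿cong (trans (δ.hom-* _ _) (*-cong (δ.hom-ι _) (δ.hom-* _ _)))) ⟩
    δ f * δ f + δ g * δ g - 2# * (δ (δ g) * δ (δ g)) ∎

  -- Let d be the difference of the two sides. Squaring `θ-dissection` and inserting `θ*θ̂` yields d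
  -- = -2 δ d, whose only solution is 0 because 1 ≠ -2.
  θ²-dissection : θ * θ + σ θ * σ θ ≈ 2# * (δ (σ θ) * δ (σ θ))
  θ²-dissection = x-y≈0⇒x≈y _ _ (dilation-eq⇒0 1# (ι (ℤ.- + 2))
    (λ e → contradiction (≡.trans (≡.sym (ι-head 1ℤ)) e) λ ())
    (λ e → contradiction (≡.trans (≡.sym (ι-head 1ℤ)) (≡.trans e (ι-head _))) λ ())
    (begin
      1# * (θ * θ + θ̂ * θ̂ - 2# * (δ θ̂ * δ θ̂))
        ≈⟨ solve 3 (λ g h k → one :* (g :* g :+ h :* h :- con (+ 2) :* k)
                    := (g :+ h) :* (g :+ h) :- con (+ 2) :* (g :* h) :- con (+ 2) :* k)
                        refl θ θ̂ (δ θ̂ * δ θ̂) ⟩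
      (θ + θ̂) * (θ + θ̂) - 2# * (θ * θ̂) - 2# * (δ θ̂ * δ θ̂)
        ≈⟨ +-congʳ (+-cong (*-cong θ-dissection θ-dissection) (-‿cong (*-congˡ θ*θ̂))) ⟩
      2# * δ (δ θ̂) * (2# * δ (δ θ̂)) - 2# * (δ θ * δ θ) - 2# * (δ θ̂ * δ θ̂)
        ≈⟨ solve 3 (λ x y z → con (+ 2) :* x :* (con (+ 2) :* x) :- con (+ 2) :* (y :* y) :- con (+ 2) :* (z :* z)
                    := con (ℤ.- + 2) :* (y :* y :+ z :* z :- con (+ 2) :* (x :* x)))
                        refl (δ (δ θ̂)) (δ θ) (δ θ̂) ⟩
      ι (ℤ.- + 2) * (δ θ * δ θ + δ θ̂ * δ θ̂ - 2# * (δ (δ θ̂) * δ (δ θ̂)))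
        ≈⟨ *-congˡ (sym (δ[θ²-defect] θ θ̂)) ⟩
      ι (ℤ.- + 2) * δ (θ * θ + θ̂ * θ̂ - 2# * (δ θ̂ * δ θ̂)) ∎))

  -- Eighth powers and Jacobi's quartic identity

  u u₂ u₄ u₈ : Series
  u  = E ^ 8
  u₂ = δ u
  u₄ = δ u₂
  u₈ = δ u₄

  u-monic : Monic u
  u-monic = ^-monic 8 E-monic

  u-σu : u * σ u * u₄ ≈ u₂ ^ 3
  u-σu = begin
    E ^ 8 * σ (E ^ 8) * δ (δ (E ^ 8))
      ≈⟨ *-cong (*-congˡ (σ.hom-^ E 8)) (trans (δ.hom-cong (δ.hom-^ E 8)) (δ.hom-^ _ 8)) ⟩
    E ^ 8 * σ E ^ 8 * δ (δ E) ^ 8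
      ≈⟨ solve 3 (λ a b c → a :^ 8 :* b :^ 8 :* c :^ 8 := (a :* b :* c) :^ 8) refl E (σ E) E₄ ⟩
    (E * σ E * δ (δ E)) ^ 8
      ≈⟨ ^-congˡ 8 E-σE ⟩
    (δ E * (δ E * δ E)) ^ 8
      ≈⟨ solve 1 (λ a → (a :* (a :* a)) :^ 8 := (a :^ 8) :^ 3) refl (δ E) ⟩
    (δ E ^ 8) ^ 3
      ≈⟨ ^-congˡ 3 (sym (δ.hom-^ E 8)) ⟩
    u₂ ^ 3 ∎

  q-zero : ∀ f → (q^ 1 * f) 0 ≡ 0ℤ
  q-zero f = q^-zero 0 f

  q-suc : ∀ f n → (q^ 1 * f) (suc n) ≡ f n
  q-suc f n = ≡.trans (q^-suc 0 f n) (coeff (trans (*-congʳ (sym (pointwise ι1-coeff))) (*-identityˡ f)) n)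

  q-cancel : ∀ {f g} → q^ 1 * f ≈ q^ 1 * g → f ≈ g
  q-cancel {f} {g} eq = pointwise λ n → ≡.trans (≡.sym (q-suc f n)) (≡.trans (coeff eq (suc n)) (q-suc g n))

  q-tail : ∀ f → f 0 ≡ 0ℤ → f ≈ q^ 1 * tail f
  q-tail f f₀≡0 = pointwise λ
    { zero    → ≡.trans f₀≡0 (≡.sym (q-zero (tail f)))
    ; (suc n) → ≡.sym (q-suc (tail f) n) }

  -- Z = σu - u and 16 q u₄ both satisfy Z² u₈ = 16 u₄² δZ, which together with
  -- the leading coefficient determines a series.

  private
    Z z : Series
    Z = σ u - u
    z = tail Z

    u≈θ : u ≈ (θ * E₂) ^ 4
    u≈θ = trans (solve 1 (λ a → a :^ 8 := (a :* a) :^ 4) refl E) (^-congˡ 4 (sym gauss))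

    σu≈θ : σ u ≈ (θ̂ * E₂) ^ 4
    σu≈θ = begin
      σ (E ^ 8)        ≈⟨ σ.hom-^ E 8 ⟩
      σ E ^ 8          ≈⟨ solve 1 (λ a → a :^ 8 := (a :* a) :^ 4) refl (σ E) ⟩
      (σ E * σ E) ^ 4  ≈⟨ ^-congˡ 4 (sym gauss-σ) ⟩
      (θ̂ * E₂) ^ 4 ∎

    Z≈ : Z ≈ E₂ ^ 4 * (θ̂ ^ 4 - θ ^ 4)
    Z≈ = trans (+-cong σu≈θ (-‿cong u≈θ))
      (solve 3 (λ g h a → (h :* a) :^ 4 :- (g :* a) :^ 4 := a :^ 4 :* (h :^ 4 :- g :^ 4)) refl θ θ̂ E₂)

    δZ≈ : δ Z ≈ E₄ ^ 4 * (δ θ̂ ^ 4 - δ θ ^ 4)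
    δZ≈ = begin
      δ Z ≈⟨ δ.hom-cong Z≈ ⟩
      δ (E₂ ^ 4 * (θ̂ ^ 4 - θ ^ 4)) ≈⟨ δ.hom-* _ _ ⟩
      δ (E₂ ^ 4) * δ (θ̂ ^ 4 - θ ^ 4)
        ≈⟨ *-cong (δ.hom-^ E₂ 4) (trans (δ.hom-+ _ _) (+-cong (δ.hom-^ θ̂ 4) (trans (δ.hom-neg _) (-‿cong (δ.hom-^ θ 4))))) ⟩
      E₄ ^ 4 * (δ θ̂ ^ 4 - δ θ ^ 4) ∎

    -- The identity (h⁴ - g⁴)² = (g² + h²)² ((g² + h²)² - 4 (gh)²) expresses the square through g² +
    -- h² and gh, both of which have been evaluated in terms of q².
    Z² : Z * Z ≈ ι (+ 16) * E₂ ^ 8 * δ θ̂ ^ 4 * (δ θ̂ ^ 4 - δ θ ^ 4)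
    Z² = begin
      Z * Z
        ≈⟨ *-cong Z≈ Z≈ ⟩
      E₂ ^ 4 * (θ̂ ^ 4 - θ ^ 4) * (E₂ ^ 4 * (θ̂ ^ 4 - θ ^ 4))
        ≈⟨ solve 3 (λ a g h → a :^ 4 :* (h :^ 4 :- g :^ 4) :* (a :^ 4 :* (h :^ 4 :- g :^ 4))
             := a :^ 8 :* ((g :* g :+ h :* h) :^ 2 :* ((g :* g :+ h :* h) :^ 2 :- con (+ 4) :* (g :* h) :^ 2)))
                 refl E₂ θ θ̂ ⟩
      E₂ ^ 8 * ((θ * θ + θ̂ * θ̂) ^ 2 * ((θ * θ + θ̂ * θ̂) ^ 2 - ι (+ 4) * (θ * θ̂) ^ 2))
        ≈⟨ *-congˡ (*-cong (^-congˡ 2 θ²-dissection) (+-cong (^-congˡ 2 θ²-dissection) (-‿cong (*-congˡ (^-congˡ 2 θ*θ̂))))) ⟩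
      E₂ ^ 8 * ((2# * (δ θ̂ * δ θ̂)) ^ 2 * ((2# * (δ θ̂ * δ θ̂)) ^ 2 - ι (+ 4) * (δ θ * δ θ) ^ 2))
        ≈⟨ solve 3 (λ a g h → a :^ 8 :* ((con (+ 2) :* (h :* h)) :^ 2 :* ((con (+ 2) :* (h :* h)) :^ 2 :- con (+ 4) :* (g :* g) :^ 2))
             := con (+ 16) :* a :^ 8 :* h :^ 4 :* (h :^ 4 :- g :^ 4)) refl E₂ (δ θ) (δ θ̂) ⟩
      ι (+ 16) * E₂ ^ 8 * δ θ̂ ^ 4 * (δ θ̂ ^ 4 - δ θ ^ 4) ∎

    δ^8 : ∀ f → δ f ^ 8 ≈ δ (f ^ 8)
    δ^8 f = sym (δ.hom-^ f 8)

    -- Of the extra factor u₄ = E₄⁸, one half turns (δ θ̂)⁴ into the eighth power of `δ (σ E)` by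
    -- Gauss and the other half completes `δ Z`. Then `δE-σE` eliminates `δ (σ E)`.
    Z²-dilation : Z * Z * u₈ ≈ ι (+ 16) * (u₄ * u₄) * δ Z
    Z²-dilation = *-cancelˡ u₄ (monic⇒≢0 {u₄} (δ-monic (δ-monic u-monic))) (begin
      u₄ * (Z * Z * u₈)
        ≈⟨ *-cong (sym u₄≈) (*-cong Z² (sym u₈≈)) ⟩
      E₄ ^ 8 * (ι (+ 16) * E₂ ^ 8 * δ θ̂ ^ 4 * w * E₈ ^ 8)
        ≈⟨ solve 5 (λ a b c h w → b :^ 8 :* (con (+ 16) :* a :^ 8 :* h :^ 4 :* w :* c :^ 8)
              := con (+ 16) :* a :^ 8 :* (h :* b) :^ 4 :* c :^ 8 :* (b :^ 4 :* w)) refl E₂ E₄ E₈ (δ θ̂) w ⟩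
      ι (+ 16) * E₂ ^ 8 * (δ θ̂ * E₄) ^ 4 * E₈ ^ 8 * (E₄ ^ 4 * w)
        ≈⟨ *-cong (*-congʳ (*-congˡ (^-congˡ 4 (δ-eq gauss-σ)))) (sym δZ≈) ⟩
      ι (+ 16) * E₂ ^ 8 * (δ (σ E) * δ (σ E)) ^ 4 * E₈ ^ 8 * δ Z
        ≈⟨ *-congʳ (solve 3 (λ a s c → con (+ 16) :* a :^ 8 :* (s :* s) :^ 4 :* c :^ 8 := con (+ 16) :* (a :* s :* c) :^ 8)
            refl E₂ (δ (σ E)) E₈) ⟩
      ι (+ 16) * (E₂ * δ (σ E) * E₈) ^ 8 * δ Z
        ≈⟨ *-congʳ (*-congˡ (^-congˡ 8 δE-σE)) ⟩
      ι (+ 16) * (E₄ * (E₄ * E₄)) ^ 8 * δ Z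
        ≈⟨ *-congʳ (solve 1 (λ a → con (+ 16) :* (a :* (a :* a)) :^ 8 := a :^ 8 :* (con (+ 16) :* (a :^ 8 :* a :^ 8)))
            refl E₄) ⟩
      E₄ ^ 8 * (ι (+ 16) * (E₄ ^ 8 * E₄ ^ 8)) * δ Z
        ≈⟨ trans (*-congʳ (*-cong u₄≈ (*-congˡ (*-cong u₄≈ u₄≈)))) (*-assoc _ _ _) ⟩
      u₄ * (ι (+ 16) * (u₄ * u₄) * δ Z) ∎)
      where
      w = δ θ̂ ^ 4 - δ θ ^ 4
      u₄≈ : E₄ ^ 8 ≈ u₄
      u₄≈ = trans (δ^8 E₂) (δ.hom-cong (δ^8 E))
      u₈≈ : E₈ ^ 8 ≈ u₈
      u₈≈ = trans (δ^8 E₄) (δ.hom-cong u₄≈)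
      δE-σE : E₂ * δ (σ E) * E₈ ≈ E₄ * (E₄ * E₄)
      δE-σE = begin
        E₂ * δ (σ E) * E₈          ≈⟨ *-congʳ (sym (δ.hom-* _ _)) ⟩
        δ (E * σ E) * E₈           ≈⟨ sym (δ.hom-* _ _) ⟩
        δ (E * σ E * E₄)           ≈⟨ δ.hom-cong E-σE ⟩
        δ (E₂ * (E₂ * E₂))         ≈⟨ trans (δ.hom-* _ _) (*-congˡ (δ.hom-* _ _)) ⟩
        E₄ * (E₄ * E₄) ∎

    Z-head : Z 0 ≡ 0ℤ
    Z-head = ≡.trans (⊕-coeff (σ u) (- u) 0)
      (cong₂ ℤ._+_ (≡.trans (σ-head u) u-monic) (≡.trans (⊝-coeff u 0) (cong ℤ.-_ u-monic)))

    z-head : z 0 ≡ + 16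
    z-head = ≡.trans (⊕-coeff (σ u) (- u) 1)
      (cong₂ ℤ._+_ (≡.trans (σ-odd u 0) (cong ℤ.-_ u₁)) (≡.trans (⊝-coeff u 1) (cong ℤ.-_ u₁)))
      where
      u₁ : u 1 ≡ ℤ.- (+ 8)
      -- Multiplication of series is opaque, so the coefficient is computed from the defining
      -- product: `p 8 1` evaluates to -8.
      u₁ = ≡.sym (coeff (p≈E^ 8) 1)

    -- Subtracting the two quadratic equations gives a dilation equation for z - y with coefficient
    -- (z + y) u₈. Its constant term 16 + 16 = 32 is neither 0 nor the 16 on the other side, so z -
    -- y vanishes.
    z≈ : z ≈ ι (+ 16) * u₄
    z≈ = x-y≈0⇒x≈y z y (dilation-eq⇒0 ((z + y) * u₈) (ι (+ 16) * (u₄ * u₄))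
      (λ e → contradiction (≡.trans (≡.sym c-head) e) λ ())
      (λ e → contradiction (≡.trans (≡.sym c-head) (≡.trans e b-head)) λ ())
      (begin
        (z + y) * u₈ * (z - y)
          ≈⟨ solve 3 (λ z c d → (z :+ con (+ 16) :* c) :* d :* (z :- con (+ 16) :* c) := z :* z :* d :- con (+ 16) :* (c :* c) :* (con (+ 16) :* d))
              refl z u₄ u₈ ⟩
        z * z * u₈ - ι (+ 16) * (u₄ * u₄) * (ι (+ 16) * u₈)
          ≈⟨ +-cong z²-dilation (-‿cong (*-congˡ (sym (trans (δ.hom-* _ _) (*-congʳ (δ.hom-ι _)))))) ⟩
        ι (+ 16) * (u₄ * u₄) * δ z - ι (+ 16) * (u₄ * u₄) * δ y
          ≈⟨ sym (trans (*-congˡ (trans (δ.hom-+ _ _) (+-congˡ (δ.hom-neg _)))) (x[y-z]≈xy-xz _ _ _)) ⟩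
        ι (+ 16) * (u₄ * u₄) * δ (z - y) ∎))
      where
      y = ι (+ 16) * u₄
      y-head : y 0 ≡ + 16
      y-head = ≡.trans (∙-zero _ _) (cong₂ ℤ._*_ (ι-head _) (δ-monic (δ-monic u-monic)))
      c-head : ((z + y) * u₈) 0 ≡ + 32
      c-head = ≡.trans (∙-zero _ _) (cong₂ ℤ._*_ (≡.trans (⊕-coeff z y 0) (cong₂ ℤ._+_ z-head y-head)) (δ-monic (δ-monic (δ-monic u-monic))))
      b-head : (ι (+ 16) * (u₄ * u₄)) 0 ≡ + 16
      b-head = ≡.trans (∙-zero _ _) (cong₂ ℤ._*_ (ι-head _) (*-monic {u₄} {u₄} (δ-monic (δ-monic u-monic)) (δ-monic (δ-monic u-monic))))
      q = q^ 1
      Z≈qz : Z ≈ q * z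
      Z≈qz = q-tail Z Z-head
      z²-dilation : z * z * u₈ ≈ ι (+ 16) * (u₄ * u₄) * δ z
      z²-dilation = q-cancel (q-cancel (begin
        q * (q * (z * z * u₈))
          ≈⟨ solve 3 (λ q z d → q :* (q :* (z :* z :* d)) := (q :* z) :* (q :* z) :* d) refl q z u₈ ⟩
        (q * z) * (q * z) * u₈
          ≈⟨ *-congʳ (sym (*-cong Z≈qz Z≈qz)) ⟩
        Z * Z * u₈
          ≈⟨ Z²-dilation ⟩
        ι (+ 16) * (u₄ * u₄) * δ Z
          ≈⟨ *-congˡ (trans (δ.hom-cong Z≈qz) (trans (δ.hom-* q z) (*-congʳ (trans δq (q^-+ 1 1))))) ⟩
        ι (+ 16) * (u₄ * u₄) * (q * q * δ z)
          ≈⟨ solve 3 (λ c q w → c :* (q :* q :* w) := q :* (q :* (c :* w)))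
              refl (ι (+ 16) * (u₄ * u₄)) q (δ z) ⟩
        q * (q * (ι (+ 16) * (u₄ * u₄) * δ z)) ∎))

  -- This is θ₃⁴ = θ₄⁴ + θ₂⁴ multiplied by E₂⁴.
  jacobi : σ u ≈ u + ι (+ 16) * (q^ 1 * u₄)
  jacobi = begin
    σ u             ≈⟨ solve 2 (λ x y → x := y :+ (x :- y)) refl (σ u) u ⟩
    u + Z           ≈⟨ +-congˡ (trans (q-tail Z Z-head) (*-congˡ z≈)) ⟩
    u + q^ 1 * (ι (+ 16) * u₄)
      ≈⟨ solve 3 (λ u q v → u :+ q :* (con (+ 16) :* v) := u :+ con (+ 16) :* (q :* v)) refl u (q^ 1) u₄ ⟩
    u + ι (+ 16) * (q^ 1 * u₄) ∎

-- Even and odd parts of the powers of u and of the companion g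

module Dissections where
  open PowerSeries
  open Substitution
  open Products
  open Jacobi
  open import Algebra.Properties.Ring ring using (x[y-z]≈xy-xz)
  open import Relation.Binary.Reasoning.Setoid setoid

  ev : Series → Series
  ev f n = f (n ℕ.* 2)

  -- Keeping a factor 2 on both sides avoids halving a series; it is cancelled in ℤ at each
  -- coefficient.
  even-part : ∀ {f h} → f + σ f ≈ 2# * δ h → ∀ n → f (n ℕ.* 2) ≡ h n
  even-part {f} {h} eq n = ℤ.*-cancelˡ-≡ (+ 2) _ _ (≡.trans (double (f m)) (≡.trans
    (≡.sym (≡.trans (⊕-coeff f (σ f) m) (cong (λ x → f m ℤ.+ x) (σ-even f n))))
    (≡.trans (coeff eq m) (≡.trans (ι-coeff (+ 2) (δ h) m) (cong (+ 2 ℤ.*_) (δ-even h n))))))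
    where
    m = n ℕ.* 2
    double : ∀ x → + 2 ℤ.* x ≡ x ℤ.+ x
    double = ℤ-Tactic.solve-∀

  odd-part : ∀ {f h} → f - σ f ≈ 2# * (q^ 1 * δ h) → ∀ n → f (suc (n ℕ.* 2)) ≡ h n
  odd-part {f} {h} eq n = ℤ.*-cancelˡ-≡ (+ 2) _ _ (≡.trans (double (f m)) (≡.trans
    (≡.sym (≡.trans (⊕-coeff f (- σ f) m) (cong (λ x → f m ℤ.+ x)
      (≡.trans (⊝-coeff (σ f) m) (cong ℤ.-_ (σ-odd f n))))))
    (≡.trans (coeff eq m) (≡.trans (ι-coeff (+ 2) (q^ 1 * δ h) m)
      (cong (+ 2 ℤ.*_) (≡.trans (q-suc (δ h) (n ℕ.* 2)) (δ-even h n)))))))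
    where
    m = suc (n ℕ.* 2)
    double : ∀ x → + 2 ℤ.* x ≡ x ℤ.+ ℤ.- (ℤ.- x)
    double = ℤ-Tactic.solve-∀

  -- Invariance under q ↦ -q makes each odd coefficient equal to its negative, hence 0.
  δ-ev : ∀ {f} → σ f ≈ f → δ (ev f) ≈ f
  δ-ev {f} σf≈f = pointwise λ n → go (parity n)
    where
    neg-fixed : ∀ x → ℤ.- x ≡ x → x ≡ 0ℤ
    neg-fixed x e = *≡0⇒≡0 {+ 2} x (λ ()) (≡.trans (double x) (≡.trans (cong (λ y → x ℤ.- y) e) (ℤ.+-inverseʳ x)))
      where
      double : ∀ x → + 2 ℤ.* x ≡ x ℤ.- ℤ.- x
      double = ℤ-Tactic.solve-∀
    go : ∀ {n} → Parity n → δ (ev f) n ≡ f n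
    go (even n) = δ-even (ev f) n
    go (odd n)  = ≡.trans (δ-odd (ev f) n)
      (≡.sym (neg-fixed _ (≡.trans (≡.sym (σ-odd f n)) (coeff σf≈f (suc (n ℕ.* 2))))))

  δ-injective : ∀ {f g} → δ f ≈ δ g → f ≈ g
  δ-injective {f} {g} e = pointwise λ n → ≡.trans (≡.sym (δ-even f n)) (≡.trans (coeff e (n ℕ.* 2)) (δ-even g n))

  σ² : ∀ f → σ (σ f) ≈ f
  σ² f = pointwise λ n → go (parity n)
    where
    go : ∀ {n} → Parity n → σ (σ f) n ≡ f n
    go (even n) = ≡.trans (σ-even (σ f) n) (σ-even f n)
    go (odd n)  = ≡.trans (σ-odd (σ f) n) (≡.trans (cong ℤ.-_ (σ-odd f n)) (ℤ.neg-involutive _))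

  q = q^ 1

  σu^ : ∀ k → σ (u ^ k) ≈ (u + ι (+ 16) * (q * u₄)) ^ k
  σu^ k = trans (σ.hom-^ u k) (^-congˡ k jacobi)

  δq* : ∀ f → δ (q * f) ≈ q * (q * δ f)
  δq* f = trans (δ.hom-* q f) (trans (*-congʳ (trans δq (q^-+ 1 1))) (*-assoc q q (δ f)))

  δι* : ∀ a f → δ (ι a * f) ≈ ι a * δ f
  δι* a f = trans (δ.hom-* _ f) (*-congʳ (δ.hom-ι a))

  u¹-odd : ∀ n → (u ^ 1) (suc (n ℕ.* 2)) ≡ (ι (ℤ.- + 8) * δ (u ^ 1)) n
  u¹-odd = odd-part (begin
    u ^ 1 - σ (u ^ 1)
      ≈⟨ +-congˡ (-‿cong (σu^ 1)) ⟩
    u ^ 1 - (u + ι (+ 16) * (q * u₄)) ^ 1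
      ≈⟨ solve 3 (λ u q v → u :^ 1 :- (u :+ con (+ 16) :* (q :* v)) :^ 1 := con (+ 2) :* (q :* (con (ℤ.- + 8) :* v :^ 1)))
          refl u q u₄ ⟩
    2# * (q * (ι (ℤ.- + 8) * u₄ ^ 1))
      ≈⟨ *-congˡ (*-congˡ (sym (trans (δι* _ _) (*-congˡ (trans (δ.hom-cong (δ.hom-^ u 1)) (δ.hom-^ u₂ 1)))))) ⟩
    2# * (q * δ (ι (ℤ.- + 8) * δ (u ^ 1))) ∎)

  -- With t = σu - u the difference of cubes is -t (3 u σu + t²). Here t = 16 q u₄ by `jacobi`, and
  -- `u-σu` evaluates u σu u₄.
  u³-minus : u ^ 3 - σ (u ^ 3) ≈ 2# * (q * (ι (ℤ.- + 24) * u₂ ^ 3 + ι (ℤ.- + 2048) * (q * (q * u₄ ^ 3))))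
  u³-minus = begin
    u ^ 3 - σ (u ^ 3)
      ≈⟨ +-congˡ (-‿cong (σu^ 3)) ⟩
    u ^ 3 - (u + ι (+ 16) * (q * u₄)) ^ 3
      ≈⟨ solve 3 (λ u q v → u :^ 3 :- (u :+ con (+ 16) :* (q :* v)) :^ 3
            := con (+ 2) :* (q :* (con (ℤ.- + 24) :* (u :* (u :+ con (+ 16) :* (q :* v)) :* v) :+ con (ℤ.- + 2048) :* (q :* (q :* v :^ 3)))))
                refl u q u₄ ⟩
    2# * (q * (ι (ℤ.- + 24) * (u * (u + ι (+ 16) * (q * u₄)) * u₄) + ι (ℤ.- + 2048) * (q * (q * u₄ ^ 3))))
      ≈⟨ *-congˡ (*-congˡ (+-congʳ (*-congˡ (trans (*-congʳ (*-congˡ (sym jacobi))) u-σu)))) ⟩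
    2# * (q * (ι (ℤ.- + 24) * u₂ ^ 3 + ι (ℤ.- + 2048) * (q * (q * u₄ ^ 3)))) ∎

  u³-odd : ∀ n → (u ^ 3) (suc (n ℕ.* 2)) ≡ (ι (ℤ.- + 24) * u ^ 3 + ι (ℤ.- + 2048) * (q * δ (u ^ 3))) n
  u³-odd = odd-part (begin
    u ^ 3 - σ (u ^ 3)
      ≈⟨ u³-minus ⟩
    2# * (q * (ι (ℤ.- + 24) * u₂ ^ 3 + ι (ℤ.- + 2048) * (q * (q * u₄ ^ 3))))
      ≈⟨ *-congˡ (*-congˡ (sym (trans (δ.hom-+ _ _) (+-cong
           (trans (δι* _ _) (*-congˡ (δ.hom-^ u 3)))
           (trans (δι* _ _) (*-congˡ (trans (δq* _) (*-congˡ (*-congˡ (trans (δ.hom-cong (δ.hom-^ u 3)) (δ.hom-^ u₂ 3)))))))))))⟩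
    2# * (q * δ (ι (ℤ.- + 24) * u ^ 3 + ι (ℤ.- + 2048) * (q * δ (u ^ 3)))) ∎)

  -- g = u³ / u₂ comes from η(z)²⁴ / η(2z)⁸, the companion of η(z)¹⁶.

  g : Series
  g = ev (u * σ u)

  δg : δ g ≈ u * σ u
  δg = δ-ev (trans (σ.hom-* u (σ u)) (trans (*-congˡ (σ² u)) (*-comm (σ u) u)))

  -- The injective `δ` replaces `g` by u σu, and the claim becomes `u-σu`.
  g*u₂ : g * u₂ ≈ u ^ 3
  g*u₂ = δ-injective (begin
    δ (g * u₂)      ≈⟨ δ.hom-* g u₂ ⟩
    δ g * u₄        ≈⟨ *-congʳ δg ⟩
    u * σ u * u₄    ≈⟨ u-σu ⟩
    u₂ ^ 3          ≈⟨ sym (δ.hom-^ u 3) ⟩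
    δ (u ^ 3) ∎)

  -- Write u² + (σu)² as 2 u σu + (σu - u)²: the product is `δ g` and the square is 256 q² u₄².
  u²-even : ∀ n → (u ^ 2) (n ℕ.* 2) ≡ (ι (+ 128) * (q * δ (u ^ 2)) + g) n
  u²-even = even-part (begin
    u ^ 2 + σ (u ^ 2)
      ≈⟨ +-congˡ (σu^ 2) ⟩
    u ^ 2 + (u + ι (+ 16) * (q * u₄)) ^ 2
      ≈⟨ solve 3 (λ u q v → u :^ 2 :+ (u :+ con (+ 16) :* (q :* v)) :^ 2
            := con (+ 2) :* (con (+ 128) :* (q :* (q :* v :^ 2)) :+ u :* (u :+ con (+ 16) :* (q :* v))))
                refl u q u₄ ⟩
    2# * (ι (+ 128) * (q * (q * u₄ ^ 2)) + u * (u + ι (+ 16) * (q * u₄)))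
      ≈⟨ *-congˡ (+-congˡ (trans (*-congˡ (sym jacobi)) (sym δg))) ⟩
    2# * (ι (+ 128) * (q * (q * u₄ ^ 2)) + δ g)
      ≈⟨ *-congˡ (sym (trans (δ.hom-+ _ _) (+-congʳ
           (trans (δι* _ _) (*-congˡ (trans (δq* _) (*-congˡ (*-congˡ (trans (δ.hom-cong (δ.hom-^ u 2)) (δ.hom-^ u₂ 2)))))))))) ⟩
    2# * δ (ι (+ 128) * (q * δ (u ^ 2)) + g) ∎)

  -- The shorter form in `simpler` involves q σu u₄. It is rewritten so that at an even index only
  -- coefficients of u², `g` and `δ (u ^ 2)` occur, as a Hecke relation requires.
  g-odd-series : Series
  g-odd-series = ι (+ 104) * u ^ 2 + ι (ℤ.- + 128) * δ g + ι (ℤ.- + 32768) * (q * (q * δ (δ (u ^ 2))))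

  -- As u₂ is even and g u₂ = u³, the odd part of `g` is that of u³ divided by u₂. The factor u₂
  -- becomes visible in u₄³ through the image of `u-σu` under `δ`.
  g-odd : ∀ n → g (suc (n ℕ.* 2)) ≡ g-odd-series n
  g-odd = odd-part (*-cancelˡ u₂ (monic⇒≢0 {u₂} (δ-monic u-monic)) (begin
    u₂ * (g - σ g)
      ≈⟨ x[y-z]≈xy-xz u₂ g (σ g) ⟩
    u₂ * g - u₂ * σ g
      ≈⟨ +-cong (*-comm u₂ g) (-‿cong (trans (*-comm u₂ (σ g)) (trans (*-congˡ (sym (σδ u))) (sym (σ.hom-* g u₂))))) ⟩
    g * u₂ - σ (g * u₂)
      ≈⟨ +-cong g*u₂ (-‿cong (σ.hom-cong g*u₂)) ⟩
    u ^ 3 - σ (u ^ 3)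
      ≈⟨ u³-minus ⟩
    2# * (q * (ι (ℤ.- + 24) * u₂ ^ 3 + ι (ℤ.- + 2048) * (q * (q * u₄ ^ 3))))
      ≈⟨ *-congˡ (*-congˡ (+-congˡ (*-congˡ (*-congˡ (*-congˡ u₄³))))) ⟩
    2# * (q * (ι (ℤ.- + 24) * u₂ ^ 3 + ι (ℤ.- + 2048) * (q * (q * (u₂ * δ (σ u) * u₈)))))
      ≈⟨ solve 4 (λ a q s v → con (+ 2) :* (q :* (con (ℤ.- + 24) :* a :^ 3 :+ con (ℤ.- + 2048) :* (q :* (q :* (a :* s :* v)))))
           := a :* (con (+ 2) :* (q :* (con (ℤ.- + 24) :* a :^ 2 :+ con (ℤ.- + 2048) :* (q :* (q :* (s :* v)))))))
               refl u₂ q (δ (σ u)) u₈ ⟩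
    u₂ * (2# * (q * (ι (ℤ.- + 24) * u₂ ^ 2 + ι (ℤ.- + 2048) * (q * (q * (δ (σ u) * u₈))))))
      ≈⟨ *-congˡ (*-congˡ (*-congˡ (sym (trans (δ.hom-cong simpler) (trans (δ.hom-+ _ _) (+-cong
           (trans (δι* _ _) (*-congˡ (δ.hom-^ u 2)))
           (trans (δι* _ _) (*-congˡ (trans (δq* _) (*-congˡ (*-congˡ (δ.hom-* _ _)))))))))))) ⟩
    u₂ * (2# * (q * δ g-odd-series)) ∎))
    where
    u₄³ : u₄ ^ 3 ≈ u₂ * δ (σ u) * u₈
    u₄³ = begin
      u₄ ^ 3                ≈⟨ sym (δ.hom-^ u₂ 3) ⟩
      δ (u₂ ^ 3)            ≈⟨ δ.hom-cong (sym u-σu) ⟩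
      δ (u * σ u * u₄)      ≈⟨ trans (δ.hom-* _ _) (*-congʳ (δ.hom-* _ _)) ⟩
      u₂ * δ (σ u) * u₈ ∎
    simpler : g-odd-series ≈ ι (ℤ.- + 24) * u ^ 2 + ι (ℤ.- + 2048) * (q * (σ u * u₄))
    simpler = begin
      ι (+ 104) * u ^ 2 + ι (ℤ.- + 128) * δ g + ι (ℤ.- + 32768) * (q * (q * δ (δ (u ^ 2))))
        ≈⟨ +-cong (+-congˡ (*-congˡ (trans δg (*-congˡ jacobi))))
                  (*-congˡ (*-congˡ (*-congˡ (trans (δ.hom-cong (δ.hom-^ u 2)) (δ.hom-^ u₂ 2))))) ⟩
      ι (+ 104) * u ^ 2 + ι (ℤ.- + 128) * (u * (u + ι (+ 16) * (q * u₄))) + ι (ℤ.- + 32768) * (q * (q * u₄ ^ 2))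
        ≈⟨ solve 3 (λ u q v → con (+ 104) :* u :^ 2 :+ con (ℤ.- + 128) :* (u :* (u :+ con (+ 16) :* (q :* v))) :+ con (ℤ.- + 32768) :* (q :* (q :* v :^ 2))
             := con (ℤ.- + 24) :* u :^ 2 :+ con (ℤ.- + 2048) :* (q :* ((u :+ con (+ 16) :* (q :* v)) :* v)))
                 refl u q u₄ ⟩
      ι (ℤ.- + 24) * u ^ 2 + ι (ℤ.- + 2048) * (q * ((u + ι (+ 16) * (q * u₄)) * u₄))
        ≈⟨ +-congˡ (*-congˡ (*-congˡ (*-congʳ (sym jacobi)))) ⟩
      ι (ℤ.- + 24) * u ^ 2 + ι (ℤ.- + 2048) * (q * (σ u * u₄)) ∎

-- Hecke relations at 2 and their agreement with A and B

module Hecke where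
  open PowerSeries
  open Substitution
  open Products
  open Jacobi
  open Dissections

  p≈u^ : ∀ k → p (8 ℕ.* k) ≈ u ^ k
  p≈u^ k = trans (p≈E^ (8 ℕ.* k)) (sym (^-assocʳ E 8 k))

  -- If n stands for the exponent 3n + 2k, then T k n stands for 4 (3n + 2k).

  T : ℕ → ℕ → ℕ
  T k n = (k ℕ.+ n ℕ.* 2) ℕ.* 2

  -- h n is the coefficient of the companion at the exponent 3n + 2k.

  record HeckePair (k : ℕ) : Set where
    field
      h      : ℕ → ℤ
      x y    : ℤ
      u-step : ∀ n → (u ^ k) (k ℕ.+ n ℕ.* 2) ≡ A k 1 ℤ.* δ (u ^ k) n ℤ.+ B k 1 ℤ.* h n
      h-step : ∀ n → h (T k n) ≡ x ℤ.* δ (u ^ k) n ℤ.+ y ℤ.* h n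
      A-step : ∀ a → A k (suc (suc a ℕ.* 2)) ≡ A k (suc (a ℕ.* 2)) ℤ.* A k 1 ℤ.+ B k (suc (a ℕ.* 2)) ℤ.* x
      B-step : ∀ a → B k (suc (suc a ℕ.* 2)) ≡ A k (suc (a ℕ.* 2)) ℤ.* B k 1 ℤ.+ B k (suc (a ℕ.* 2)) ℤ.* y

  -- On odd indices the recurrence has two terms and both sides satisfy it, so agreement at the
  -- indices 3 and 5 suffices.
  linear-odd-steps : ∀ a b s₀ s₁ s₂ s₃ t₀ t₁ t₂ t₃ s₀′ s₁′ s₂′ s₃′ x y →
    let s = recurrence a b s₀ s₁ s₂ s₃ ; t = recurrence a b t₀ t₁ t₂ t₃ ; r = recurrence a b s₀′ s₁′ s₂′ s₃′ in
    r 3 ≡ s 1 ℤ.* x ℤ.+ t 1 ℤ.* y → r 5 ≡ s 3 ℤ.* x ℤ.+ t 3 ℤ.* y →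
    ∀ n → r (suc (suc n ℕ.* 2)) ≡ s (suc (n ℕ.* 2)) ℤ.* x ℤ.+ t (suc (n ℕ.* 2)) ℤ.* y
  linear-odd-steps a b s₀ s₁ s₂ s₃ t₀ t₁ t₂ t₃ s₀′ s₁′ s₂′ s₃′ x y e₁ e₃ = go
    where
    s = recurrence a b s₀ s₁ s₂ s₃
    t = recurrence a b t₀ t₁ t₂ t₃
    r = recurrence a b s₀′ s₁′ s₂′ s₃′
    rearrange : ∀ a b x y s t s′ t′ → a ℤ.* (s ℤ.* x ℤ.+ t ℤ.* y) ℤ.+ b ℤ.* (s′ ℤ.* x ℤ.+ t′ ℤ.* y)
      ≡ (a ℤ.* s ℤ.+ b ℤ.* s′) ℤ.* x ℤ.+ (a ℤ.* t ℤ.+ b ℤ.* t′) ℤ.* y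
    rearrange = ℤ-Tactic.solve-∀
    go : ∀ n → r (suc (suc n ℕ.* 2)) ≡ s (suc (n ℕ.* 2)) ℤ.* x ℤ.+ t (suc (n ℕ.* 2)) ℤ.* y
    go zero          = e₁
    go (suc zero)    = e₃
    go (suc (suc n)) = ≡.trans (cong₂ (λ i j → a ℤ.* i ℤ.+ b ℤ.* j) (go (suc n)) (go n))
      (rearrange a b x y (s (suc (suc n ℕ.* 2))) (t (suc (suc n ℕ.* 2))) (s (suc (n ℕ.* 2))) (t (suc (n ℕ.* 2))))

  ι*+ι* : ∀ a f b g n → (ι a * f + ι b * g) n ≡ a ℤ.* f n ℤ.+ b ℤ.* g n
  ι*+ι* a f b g n = ≡.trans (⊕-coeff _ _ n) (cong₂ ℤ._+_ (ι-coeff a f n) (ι-coeff b g n))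

  -- The Hecke eigenvalue at 2 is 0, that is b(2N) = -8 b(N/2), so the companion vanishes.
  hecke₁ : HeckePair 1
  hecke₁ = record
    { h      = λ _ → 0ℤ
    ; x      = 0ℤ
    ; y      = 0ℤ
    ; u-step = λ n → ≡.trans (u¹-odd n) (≡.trans (ι-coeff _ _ n) (≡.sym (ℤ.+-identityʳ _)))
    ; h-step = λ _ → ≡.refl
    ; A-step = linear-odd-steps _ _ _ _ _ _ _ _ _ _ _ _ _ _ _ _ ≡.refl ≡.refl
    ; B-step = linear-odd-steps _ _ _ _ _ _ _ _ _ _ _ _ _ _ _ _ ≡.refl ≡.refl
    }

  hecke₂ : HeckePair 2
  hecke₂ = record
    -- The coefficient of `g` at m belongs to the exponent 3m + 1, and 3 (n + 1) + 1 = 3n + 4. The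
    -- constants below are 104 · 128 - 32768 and 104 - 128.
    { h      = λ n → g (suc n)
    ; x      = ℤ.- (+ 19456)
    ; y      = ℤ.- (+ 24)
    ; u-step = u-step
    ; h-step = h-step
    ; A-step = linear-odd-steps _ _ _ _ _ _ _ _ _ _ _ _ _ _ _ _ ≡.refl ≡.refl
    ; B-step = linear-odd-steps _ _ _ _ _ _ _ _ _ _ _ _ _ _ _ _ ≡.refl ≡.refl
    }
    where
    b = u ^ 2
    u-step : ∀ n → b (suc n ℕ.* 2) ≡ + 128 ℤ.* δ b n ℤ.+ 1ℤ ℤ.* g (suc n)
    u-step n = ≡.trans (u²-even (suc n)) (≡.trans (⊕-coeff _ g (suc n))
      (cong₂ ℤ._+_ (≡.trans (ι-coeff _ _ (suc n)) (cong (+ 128 ℤ.*_) (q-suc (δ b) n)))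
                   (≡.sym (ℤ.*-identityˡ _))))
    h-step : ∀ n → g (suc (T 2 n)) ≡ ℤ.- (+ 19456) ℤ.* δ b n ℤ.+ ℤ.- (+ 24) ℤ.* g (suc n)
    h-step n = begin
      g (suc (suc n ℕ.* 2 ℕ.* 2))
        ≡⟨ g-odd (suc n ℕ.* 2) ⟩
      g-odd-series (suc n ℕ.* 2)
        ≡⟨ ≡.trans (⊕-coeff _ _ _) (cong₂ ℤ._+_ (ι*+ι* _ _ _ _ _) (ι-coeff _ _ _)) ⟩
      + 104 ℤ.* b (suc n ℕ.* 2) ℤ.+ ℤ.- (+ 128) ℤ.* δ g (suc n ℕ.* 2)
        ℤ.+ ℤ.- (+ 32768) ℤ.* (q * (q * δ (δ b))) (suc n ℕ.* 2)
        ≡⟨ cong₂ ℤ._+_ (cong₂ (λ i j → + 104 ℤ.* i ℤ.+ ℤ.- (+ 128) ℤ.* j) (u-step n) (δ-even g (suc n)))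
             (cong (ℤ.- (+ 32768) ℤ.*_) (≡.trans (q-suc _ (suc (n ℕ.* 2))) (≡.trans (q-suc _ (n ℕ.* 2)) (δ-even (δ b) n)))) ⟩
      + 104 ℤ.* (+ 128 ℤ.* δ b n ℤ.+ 1ℤ ℤ.* g (suc n)) ℤ.+ ℤ.- (+ 128) ℤ.* g (suc n)
        ℤ.+ ℤ.- (+ 32768) ℤ.* δ b n
        ≡⟨ arith (δ b n) (g (suc n)) ⟩
      ℤ.- (+ 19456) ℤ.* δ b n ℤ.+ ℤ.- (+ 24) ℤ.* g (suc n) ∎
      where
      open ≡-Reasoning
      arith : ∀ v w → + 104 ℤ.* (+ 128 ℤ.* v ℤ.+ 1ℤ ℤ.* w) ℤ.+ ℤ.- (+ 128) ℤ.* w ℤ.+ ℤ.- (+ 32768) ℤ.* v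
        ≡ ℤ.- (+ 19456) ℤ.* v ℤ.+ ℤ.- (+ 24) ℤ.* w
      arith = ℤ-Tactic.solve-∀

  -- Here η(3z)²⁴ is Ramanujan's Δ at 3z, an eigenform with τ(2) = -24 and 2¹¹ = 2048. Hence u³ is
  -- its own companion, read at 3 (n + 1) + 3 = 3n + 6. The constants are 24 · 2048 and 24² - 2048.
  hecke₃ : HeckePair 3
  hecke₃ = record
    { h      = λ n → b (suc n)
    ; x      = + 49152
    ; y      = ℤ.- (+ 1472)
    ; u-step = u-step
    ; h-step = h-step
    ; A-step = linear-odd-steps _ _ _ _ _ _ _ _ _ _ _ _ _ _ _ _ ≡.refl ≡.refl
    ; B-step = linear-odd-steps _ _ _ _ _ _ _ _ _ _ _ _ _ _ _ _ ≡.refl ≡.refl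
    }
    where
    b = u ^ 3
    odd-step : ∀ n → b (suc (suc n ℕ.* 2)) ≡ ℤ.- (+ 24) ℤ.* b (suc n) ℤ.+ ℤ.- (+ 2048) ℤ.* δ b n
    odd-step n = ≡.trans (u³-odd (suc n)) (≡.trans (ι*+ι* _ _ _ _ (suc n))
      (cong (λ i → ℤ.- (+ 24) ℤ.* b (suc n) ℤ.+ ℤ.- (+ 2048) ℤ.* i) (q-suc (δ b) n)))
    u-step : ∀ n → b (suc (suc n ℕ.* 2)) ≡ ℤ.- (+ 2048) ℤ.* δ b n ℤ.+ ℤ.- (+ 24) ℤ.* b (suc n)
    u-step n = ≡.trans (odd-step n) (ℤ.+-comm (ℤ.- (+ 24) ℤ.* b (suc n)) _)
    h-step : ∀ n → b (suc (T 3 n)) ≡ + 49152 ℤ.* δ b n ℤ.+ ℤ.- (+ 1472) ℤ.* b (suc n)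
    h-step n = ≡.trans (odd-step (suc n ℕ.* 2)) (≡.trans
      (cong₂ (λ i j → ℤ.- (+ 24) ℤ.* i ℤ.+ ℤ.- (+ 2048) ℤ.* j) (u-step n) (δ-even b (suc n)))
      (arith (δ b n) (b (suc n))))
      where
      arith : ∀ v w → ℤ.- (+ 24) ℤ.* (ℤ.- (+ 2048) ℤ.* v ℤ.+ ℤ.- (+ 24) ℤ.* w) ℤ.+ ℤ.- (+ 2048) ℤ.* w
        ≡ + 49152 ℤ.* v ℤ.+ ℤ.- (+ 1472) ℤ.* w
      arith = ℤ-Tactic.solve-∀

  heckePair : ∀ {k} → 1 ℕ.≤ k → k ℕ.≤ 3 → HeckePair k
  heckePair {1} _ _ = hecke₁
  heckePair {2} _ _ = hecke₂
  heckePair {3} _ _ = hecke₃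
  heckePair {suc (suc (suc (suc _)))} _ (s≤s (s≤s (s≤s ())))

  -- Iterating the Hecke relations and locating the indices

  T^ : ℕ → ℕ → ℕ → ℕ
  T^ k zero    n = n
  T^ k (suc a) n = T k (T^ k a n)

  T^-+ : ∀ k a b n → T^ k (a ℕ.+ b) n ≡ T^ k a (T^ k b n)
  T^-+ k zero    b n = ≡.refl
  T^-+ k (suc a) b n = cong (T k) (T^-+ k a b n)

  -- In terms of N = 3n + 2k, the value `δ (u ^ k) n` is b(N/2), and a + 1 applications of `T k`
  -- multiply N by 4^(a+1). The left side is therefore b(2^(2a+1) N).
  δu-T^ : ∀ {k} (H : HeckePair k) a n →
    δ (u ^ k) (T^ k (suc a) n) ≡ A k (suc (a ℕ.* 2)) ℤ.* δ (u ^ k) n ℤ.+ B k (suc (a ℕ.* 2)) ℤ.* HeckePair.h H n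
  δu-T^ {k} H zero n = ≡.trans (δ-even (u ^ k) (k ℕ.+ n ℕ.* 2)) (HeckePair.u-step H n)
  δu-T^ {k} H (suc a) n = begin
    δ (u ^ k) (T^ k (2 ℕ.+ a) n)
      -- One application of `T k` is moved innermost, so that the induction hypothesis applies at
      -- `T k n` and the basic relations finish.
      ≡⟨ cong (δ (u ^ k)) (≡.trans (cong (λ i → T^ k i n) (≡.sym (ℕ.+-comm (suc a) 1))) (T^-+ k (suc a) 1 n)) ⟩
    δ (u ^ k) (T^ k (suc a) (T k n))
      ≡⟨ δu-T^ H a (T k n) ⟩
    A k (suc (a ℕ.* 2)) ℤ.* δ (u ^ k) (T k n) ℤ.+ B k (suc (a ℕ.* 2)) ℤ.* h (T k n)
      ≡⟨ cong₂ (λ i j → A k (suc (a ℕ.* 2)) ℤ.* i ℤ.+ B k (suc (a ℕ.* 2)) ℤ.* j) (δu-T^ H 0 n) (h-step n) ⟩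
    A k (suc (a ℕ.* 2)) ℤ.* (A k 1 ℤ.* δ (u ^ k) n ℤ.+ B k 1 ℤ.* h n)
      ℤ.+ B k (suc (a ℕ.* 2)) ℤ.* (x ℤ.* δ (u ^ k) n ℤ.+ y ℤ.* h n)
      ≡⟨ arith (A k (suc (a ℕ.* 2))) (B k (suc (a ℕ.* 2))) (A k 1) (B k 1) x y (δ (u ^ k) n) (h n) ⟩
    (A k (suc (a ℕ.* 2)) ℤ.* A k 1 ℤ.+ B k (suc (a ℕ.* 2)) ℤ.* x) ℤ.* δ (u ^ k) n
      ℤ.+ (A k (suc (a ℕ.* 2)) ℤ.* B k 1 ℤ.+ B k (suc (a ℕ.* 2)) ℤ.* y) ℤ.* h n
      ≡⟨ ≡.sym (cong₂ (λ i j → i ℤ.* δ (u ^ k) n ℤ.+ j ℤ.* h n) (A-step a) (B-step a)) ⟩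
    A k (suc (suc a ℕ.* 2)) ℤ.* δ (u ^ k) n ℤ.+ B k (suc (suc a ℕ.* 2)) ℤ.* h n ∎
    where
    open HeckePair H
    open ≡-Reasoning
    arith : ∀ A B A₁ B₁ x y v w → A ℤ.* (A₁ ℤ.* v ℤ.+ B₁ ℤ.* w) ℤ.+ B ℤ.* (x ℤ.* v ℤ.+ y ℤ.* w)
      ≡ (A ℤ.* A₁ ℤ.+ B ℤ.* x) ℤ.* v ℤ.+ (A ℤ.* B₁ ℤ.+ B ℤ.* y) ℤ.* w
    arith = ℤ-Tactic.solve-∀

  -- This is k (4^a - 1) / 3, defined without division.
  offset : ℕ → ℕ → ℕ
  offset k zero    = 0
  offset k (suc a) = k ℕ.+ offset k a ℕ.* 4

  T^-closed : ∀ k a n → T^ k a n ≡ 4 ℕ.^ a ℕ.* n ℕ.+ 2 ℕ.* offset k a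
  T^-closed k zero    n = ≡.sym (≡.trans (ℕ.+-identityʳ _) (ℕ.+-identityʳ n))
  T^-closed k (suc a) n = ≡.trans (cong (T k) (T^-closed k a n)) (arith k (4 ℕ.^ a) n (offset k a))
    where
    arith : ∀ k w n s → (k ℕ.+ (w ℕ.* n ℕ.+ 2 ℕ.* s) ℕ.* 2) ℕ.* 2 ≡ 4 ℕ.* w ℕ.* n ℕ.+ 2 ℕ.* (k ℕ.+ s ℕ.* 4)
    arith = ℕ-Tactic.solve-∀

  offset-closed : ∀ k a → offset k a ℕ.* 3 ℕ.+ k ≡ k ℕ.* 4 ℕ.^ a
  offset-closed k zero    = ≡.sym (ℕ.*-identityʳ k)
  offset-closed k (suc a) = ≡.trans (arith₁ k (offset k a)) (≡.trans (cong (4 ℕ.*_) (offset-closed k a)) (arith₂ k (4 ℕ.^ a)))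
    where
    arith₁ : ∀ k s → (k ℕ.+ s ℕ.* 4) ℕ.* 3 ℕ.+ k ≡ 4 ℕ.* (s ℕ.* 3 ℕ.+ k)
    arith₁ = ℕ-Tactic.solve-∀
    arith₂ : ∀ k w → 4 ℕ.* (k ℕ.* w) ≡ k ℕ.* (4 ℕ.* w)
    arith₂ = ℕ-Tactic.solve-∀

  -- Since `T k` ends in a doubling, `δ (u ^ k)` at `T^ k (suc a) n` is the coefficient of u^k at
  -- this index.
  index : ∀ k a n → k ℕ.+ T^ k a n ℕ.* 2 ≡ 2 ℕ.* 4 ℕ.^ a ℕ.* n ℕ.+ offset k (suc a)
  index k a n = ≡.trans (cong (λ i → k ℕ.+ i ℕ.* 2) (T^-closed k a n)) (arith k (4 ℕ.^ a) n (offset k a))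
    where
    arith : ∀ k w n s → k ℕ.+ (w ℕ.* n ℕ.+ 2 ℕ.* s) ℕ.* 2 ≡ 2 ℕ.* w ℕ.* n ℕ.+ (k ℕ.+ s ℕ.* 4)
    arith = ℕ-Tactic.solve-∀

  2^2a : ∀ a → 2 ℕ.^ (2 ℕ.* a) ≡ 4 ℕ.^ a
  2^2a a = ≡.sym (ℕ.^-*-assoc 2 2 a)

  2*1+a∸1 : ∀ a → 2 ℕ.* suc a ℕ.∸ 1 ≡ suc (2 ℕ.* a)
  2*1+a∸1 a = ℕ.+-suc a (a ℕ.+ 0)

  2^[2a-1] : ∀ a → 2 ℕ.^ (2 ℕ.* suc a ℕ.∸ 1) ≡ 2 ℕ.* 4 ℕ.^ a
  2^[2a-1] a = ≡.trans (cong (2 ℕ.^_) (2*1+a∸1 a)) (cong (2 ℕ.*_) (2^2a a))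

  -- The exponent `e` is a variable because `2 * μ * α` is equal but not convertible to `2 * suc a`.
  -- The division is exact: the numerator is three times the offset.
  index-ii : ∀ k a n {e} → e ≡ 2 ℕ.* suc a →
    2 ℕ.^ (e ℕ.∸ 1) ℕ.* n ℕ.+ (k ℕ.* (2 ℕ.^ e ℕ.∸ 1)) ℕ./ 3 ≡ k ℕ.+ T^ k a n ℕ.* 2
  index-ii k a n ≡.refl = ≡.trans (cong₂ (λ i j → i ℕ.* n ℕ.+ j) (2^[2a-1] a) quotient) (≡.sym (index k a n))
    where
    quotient : (k ℕ.* (2 ℕ.^ (2 ℕ.* suc a) ℕ.∸ 1)) ℕ./ 3 ≡ offset k (suc a)
    quotient = ≡.trans (cong (ℕ._/ 3) (≡.trans (ℕ.*-distribˡ-∸ k (2 ℕ.^ (2 ℕ.* suc a)) 1)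
      (≡.trans (cong₂ ℕ._∸_ (≡.trans (cong (k ℕ.*_) (2^2a (suc a))) (≡.sym (offset-closed k (suc a)))) (ℕ.*-identityʳ k))
               (ℕ.m+n∸n≡m (offset k (suc a) ℕ.* 3) k))))
      (m*n/n≡m (offset k (suc a)) 3)

  -- This is the index of part (ii) taken at 2n + 1. By `numerator` both the truncated subtraction
  -- and the division by 3 are exact.
  index-i : ∀ k a n {e} → e ≡ 2 ℕ.* suc a →
    2 ℕ.^ e ℕ.* n ℕ.+ ((2 ℕ.* k ℕ.+ 3) ℕ.* 2 ℕ.^ (e ℕ.∸ 1) ℕ.∸ k) ℕ./ 3
    ≡ k ℕ.+ T^ k a (suc (n ℕ.* 2)) ℕ.* 2
  index-i k a n ≡.refl = ≡.trans (cong₂ (λ i j → i ℕ.* n ℕ.+ j) (2^2a (suc a)) quotient)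
    (≡.trans (arith (4 ℕ.^ a) n (offset k (suc a))) (≡.sym (index k a (suc (n ℕ.* 2)))))
    where
    arith : ∀ w n s → 4 ℕ.* w ℕ.* n ℕ.+ (2 ℕ.* w ℕ.+ s) ≡ 2 ℕ.* w ℕ.* suc (n ℕ.* 2) ℕ.+ s
    arith = ℕ-Tactic.solve-∀
    arith₁ : ∀ k w → (2 ℕ.* k ℕ.+ 3) ℕ.* (2 ℕ.* w) ≡ 2 ℕ.* w ℕ.* 3 ℕ.+ k ℕ.* (4 ℕ.* w)
    arith₁ = ℕ-Tactic.solve-∀
    arith₂ : ∀ k w s → 2 ℕ.* w ℕ.* 3 ℕ.+ (s ℕ.* 3 ℕ.+ k) ≡ (2 ℕ.* w ℕ.+ s) ℕ.* 3 ℕ.+ k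
    arith₂ = ℕ-Tactic.solve-∀
    numerator : (2 ℕ.* k ℕ.+ 3) ℕ.* 2 ℕ.^ (2 ℕ.* suc a ℕ.∸ 1) ≡ (2 ℕ.* 4 ℕ.^ a ℕ.+ offset k (suc a)) ℕ.* 3 ℕ.+ k
    numerator = ≡.trans (cong ((2 ℕ.* k ℕ.+ 3) ℕ.*_) (2^[2a-1] a)) (≡.trans (arith₁ k (4 ℕ.^ a))
      (≡.trans (cong (2 ℕ.* 4 ℕ.^ a ℕ.* 3 ℕ.+_) (≡.sym (offset-closed k (suc a)))) (arith₂ k (4 ℕ.^ a) (offset k (suc a)))))
    quotient : ((2 ℕ.* k ℕ.+ 3) ℕ.* 2 ℕ.^ (2 ℕ.* suc a ℕ.∸ 1) ℕ.∸ k) ℕ./ 3 ≡ 2 ℕ.* 4 ℕ.^ a ℕ.+ offset k (suc a)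
    quotient = ≡.trans (cong (ℕ._/ 3) (≡.trans (cong (ℕ._∸ k) numerator) (ℕ.m+n∸n≡m ((2 ℕ.* 4 ℕ.^ a ℕ.+ offset k (suc a)) ℕ.* 3) k)))
      (m*n/n≡m (2 ℕ.* 4 ℕ.^ a ℕ.+ offset k (suc a)) 3)

  -- Reduction modulo m

  [mod]0⇒∣ : ∀ {m} a → a ≡ 0ℤ [mod m ] → + m ∣ a
  [mod]0⇒∣ {m} a e = subst (+ m ∣_) (ℤ.+-identityʳ a) (∣ᵤ⇒∣ e)

  ∣⇒[mod]0 : ∀ {m} a → + m ∣ a → a ≡ 0ℤ [mod m ]
  ∣⇒[mod]0 {m} a e = ∣⇒∣ᵤ (subst (+ m ∣_) (≡.sym (ℤ.+-identityʳ a)) e)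

  -- Here `μ` is one less than the minimum of the theorem, so the index 2μ - 1 there reads
  -- `suc (μ * 2)` here.
  module _ {m k μ c₁} (H : HeckePair k)
           (B≡0 : + m ∣ B k (suc (μ ℕ.* 2))) (A≡c₁ : + m ∣ c₁ ℤ.- A k (suc (μ ℕ.* 2))) where
    open HeckePair H using (h)

    -- A block of `suc μ` steps acts as multiplication by `c₁` modulo `m`, because the coefficient
    -- of the companion is divisible by `m`.
    δu≡c₁^ : ∀ α n → + m ∣ δ (u ^ k) (T^ k (α ℕ.* suc μ) n) ℤ.- c₁ ℤ.^ α ℤ.* δ (u ^ k) n
    δu≡c₁^ zero n = subst (+ m ∣_) (arith (δ (u ^ k) n)) (divides 0ℤ ≡.refl)
      where
      arith : ∀ v → 0ℤ ≡ v ℤ.- 1ℤ ℤ.* v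
      arith = ℤ-Tactic.solve-∀
    δu≡c₁^ (suc α) n = subst (+ m ∣_) (≡.sym decompose)
      (∣m∣n⇒∣m+n (∣m∣n⇒∣m+n (∣m⇒∣m*n (ℤ.- v) A≡c₁) (∣m⇒∣m*n (h n′) B≡0)) (∣n⇒∣m*n c₁ (δu≡c₁^ α n)))
      where
      n′ = T^ k (α ℕ.* suc μ) n
      v = δ (u ^ k) n′
      A′ = A k (suc (μ ℕ.* 2))
      B′ = B k (suc (μ ℕ.* 2))
      arith : ∀ A B c w h v v₀ → A ℤ.* v ℤ.+ B ℤ.* h ℤ.- c ℤ.* w ℤ.* v₀
        ≡ (c ℤ.- A) ℤ.* (ℤ.- v) ℤ.+ B ℤ.* h ℤ.+ c ℤ.* (v ℤ.- w ℤ.* v₀)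
      arith = ℤ-Tactic.solve-∀
      decompose : δ (u ^ k) (T^ k (suc α ℕ.* suc μ) n) ℤ.- c₁ ℤ.^ suc α ℤ.* δ (u ^ k) n
        ≡ (c₁ ℤ.- A′) ℤ.* (ℤ.- v) ℤ.+ B′ ℤ.* h n′ ℤ.+ c₁ ℤ.* (v ℤ.- c₁ ℤ.^ α ℤ.* δ (u ^ k) n)
      decompose = ≡.trans
        (cong (ℤ._- c₁ ℤ.^ suc α ℤ.* δ (u ^ k) n)
          (≡.trans (cong (δ (u ^ k)) (T^-+ k (suc μ) (α ℕ.* suc μ) n)) (δu-T^ H μ n′)))
        (arith A′ B′ c₁ (c₁ ℤ.^ α) (h n′) v (δ (u ^ k) n))

    p-vanishes : ∀ α a n → suc μ ℕ.* α ≡ suc a → + m ∣ c₁ ℤ.^ α ℤ.* δ (u ^ k) n →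
      p (8 ℕ.* k) (k ℕ.+ T^ k a n ℕ.* 2) ≡ 0ℤ [mod m ]
    p-vanishes α a n eq m∣ = ∣⇒[mod]0 _ (subst (+ m ∣_) value (∣m-n∣n⇒∣m (δu≡c₁^ α n) m∣))
      where
      ∣m-n∣n⇒∣m : ∀ {x y} → + m ∣ x ℤ.- y → + m ∣ y → + m ∣ x
      ∣m-n∣n⇒∣m {x} {y} d e = subst (+ m ∣_) (arith x y) (∣m∣n⇒∣m+n d e)
        where
        arith : ∀ x y → x ℤ.- y ℤ.+ y ≡ x
        arith = ℤ-Tactic.solve-∀
      i = k ℕ.+ T^ k a n ℕ.* 2
      value : δ (u ^ k) (T^ k (α ℕ.* suc μ) n) ≡ p (8 ℕ.* k) (k ℕ.+ T^ k a n ℕ.* 2)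
      value = ≡.trans (cong (λ i → δ (u ^ k) (T^ k i n)) (≡.trans (ℕ.*-comm α (suc μ)) eq))
        (≡.trans (δ-even (u ^ k) i) (≡.sym (coeff (p≈u^ k) i)))

-- The two families of congruences

open PowerSeries using () renaming (_^_ to _^ₛ_)
open Substitution using (δ-odd)
open SeriesRing using (δ)
open Jacobi using (u)
open Hecke

open import Data.Integer.Base using () renaming (_^_ to _^ℤ_)
open import Data.Nat.Base using (_+_; _*_; _∸_; _^_; _/_; _≤_)

theorem1p3 : ∀ (m k : ℕ) → 2 ≤ m → 1 ≤ k → k ≤ 3 →
    ∀ (μ : ℕ) → IsMu m k μ →
    ∀ (c₁ : ℤ) → IsC₁ m k μ c₁ →
    ((∀ (α : ℕ) → 1 ≤ α → ¬ ((c₁ ^ℤ α) ≡ 0ℤ [mod m ])) →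
    ∀ (α n : ℕ) → 1 ≤ α →
    p (8 * k) (2 ^ (2 * μ * α) * n + ((2 * k + 3) * 2 ^ (2 * μ * α ∸ 1) ∸ k) / 3)
    ≡ 0ℤ [mod m ])
    ×
    (∀ (α : ℕ) → 1 ≤ α → (c₁ ^ℤ α) ≡ 0ℤ [mod m ] →
    ∀ (n : ℕ) →
    p (8 * k) (2 ^ (2 * μ * α ∸ 1) * n + (k * (2 ^ (2 * μ * α) ∸ 1)) / 3)
    ≡ 0ℤ [mod m ])
theorem1p3 m k _ 1≤k k≤3 (suc μ) ((_ , B≡0) , _) c₁ (_ , _ , c₁≡A) = part-i , part-ii
  where
  odd-index : 2 * suc μ ∸ 1 ≡ suc (μ * 2)
  odd-index = ≡.trans (2*1+a∸1 μ) (cong suc (ℕ.*-comm 2 μ))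

  vanishes : ∀ α a n → suc μ * α ≡ suc a → + m ∣ c₁ ^ℤ α ℤ.* δ (u ^ₛ k) n →
    p (8 * k) (k + T^ k a n * 2) ≡ 0ℤ [mod m ]
  vanishes = p-vanishes {μ = μ} (heckePair 1≤k k≤3)
    (subst (λ i → + m ∣ B k i) odd-index ([mod]0⇒∣ _ B≡0))
    (subst (λ i → + m ∣ c₁ ℤ.- A k i) odd-index (∣ᵤ⇒∣ c₁≡A))

  part-i : _
  part-i _ (suc α) n _ = subst (λ i → p (8 * k) i ≡ 0ℤ [mod m ])
    (≡.sym (index-i k _ n (ℕ.*-assoc 2 (suc μ) (suc α))))
    -- At the odd index `suc (n * 2)` the exponent N is odd, so b(N/2) = 0 by `δ-odd`.
    (vanishes (suc α) _ (suc (n * 2)) ≡.refl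
      (subst (+ m ∣_)
        (≡.sym (≡.trans (cong (c₁ ^ℤ suc α ℤ.*_) (δ-odd (u ^ₛ k) n)) (ℤ.*-zeroʳ (c₁ ^ℤ suc α))))
        (divides 0ℤ ≡.refl)))

  part-ii : _
  part-ii (suc α) _ c₁^α≡0 n = subst (λ i → p (8 * k) i ≡ 0ℤ [mod m ])
    (≡.sym (index-ii k _ n (ℕ.*-assoc 2 (suc μ) (suc α))))
    -- Here the factor `c₁ ^ℤ suc α` provides the divisibility.
    (vanishes (suc α) _ n ≡.refl
      (∣m⇒∣m*n (δ (u ^ₛ k) n) ([mod]0⇒∣ (c₁ ^ℤ suc α) c₁^α≡0)))
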